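{- There is an absolute constant $C>0$ such that the following holds. Let $H$ be a $(D^8,D,\lambda)$-graph for some $D$ and $\lambda$. Define graphs $G_t$, $t\ge1$, by $G_1=H^2$, $G_2=H\otimes H$, and, for $t>2$, $G_t$ is the zig-zag product of $\left(G_{\lceil (t-1)/2\rceil}\otimes G_{\lfloor (t-1)/2\rfloor}\right)^2$ (as the large graph) with $H$ (as the small graph). Then for every $t\ge1$, $G_t$ is a $(D^{8t},D^2,\lambda_t)$-graph for some $\lambda_t\le\lambda+C\lambda^2$ (i.e. $\lambda_t=\lambda+O(\lambda^2)$). Moreover, $\mathrm{Rot}_{G_t}$ can be computed in time $\mathrm{poly}(t,\log D)$ with $\mathrm{poly}(t)$ oracle queries to $\mathrm{Rot}_H$.
   Context: For a positive integer $n$, $[n]=\{1,\dots,n\}$. Graphs are finite, undirected and regular, and may have self-loops and parallel edges. A $D$-regular graph $G$ on $[N]$ is specified by its rotation map $\mathrm{Rot}_G:[N]\times[D]\to[N]\times[D]$: $\mathrm{Rot}_G(v,i)=(w,j)$ means that the $i$-th edge incident to $v$ leads to $w$ and that this edge is the $j$-th edge incident to $w$. Thus $\mathrm{Rot}_G$ is a permutation with $\mathrm{Rot}_G\circ\mathrm{Rot}_G=\mathrm{id}$ (and any such involution specifies a $D$-regular graph). Vertex sets and sets of edge labels may be any finite sets of the right cardinality; when needed they are identified with sets $[n]$ by the standard (efficiently computable) bijections between products of intervals and intervals, e.g. the edge-label set, of size $D^8$, of the squared tensor product is identified with the vertex set of $H$. The normalized adjacency matrix of $G$ is the symmetric $N\times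 N$ matrix with $M_{u,v}=\frac1D|\{(i,j)\in[D]^2:\mathrm{Rot}_G(u,i)=(v,j)\}|$. The second largest eigenvalue in absolute value is $\lambda(G)=\max_{\alpha\perp 1_N,\,\alpha\ne0}\|M\alpha\|/\|\alpha\|$, where $1_N$ is the all-ones vector and the norm is Euclidean (with $\lambda(G)=0$ if $N=1$). An $(N,D,\lambda)$-graph is a $D$-regular graph on $N$ vertices with $\lambda(G)\le\lambda$. Square: $G^2$ is the $D^2$-regular graph on the vertices of $G$ with $\mathrm{Rot}_{G^2}(v_0,(k_1,k_2))=(v_2,(\ell_2,\ell_1))$, where $(v_1,\ell_1)=\mathrm{Rot}_G(v_0,k_1)$ and $(v_2,\ell_2)=\mathrm{Rot}_G(v_1,k_2)$. Tensor product: for $G_1$ ($D_1$-regular on $[N_1]$) and $G_2$ ($D_2$-regular on $[N_2]$), $G_1\otimes G_2$ is the $D_1D_2$-regular graph on $[N_1]\times[N_2]$ with $\mathrm{Rot}_{G_1\otimes G_2}((v,w),(i,j))=((v',w'),(i',j'))$, where $(v',i')=\mathrm{Rot}_{G_1}(v,i)$ and $(w',j')=\mathrm{Rot}_{G_2}(w,j)$. Zig-zag product: for a $D_1$-regular graph $G_1$ on $[N_1]$ (the large graph) and a $D_2$-regular graph $G_2$ on $[D_1]$ (the small graph), it is the $D_2^2$-regular graph on $[N_1]\times[D_1]$, with edge labels in $[D_2]\times[D_2]$, whose rotation map sends $((v,k),(i,j))$ to $((w,\ell),(j',i'))$, where $(k',i')=\mathrm{Rot}_{G_2}(k,i)$,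 then $(w,\ell')=\mathrm{Rot}_{G_1}(v,k')$, then $(\ell,j')=\mathrm{Rot}_{G_2}(\ell',j)$. Computation: $\mathrm{poly}(\cdot)$ denotes a fixed unspecified polynomial in its arguments. An algorithm with oracle access to a function may evaluate it on inputs of its choice at the cost of one time step per evaluation. One single algorithm, given the parameters as additional input, works for all graphs; the time and query counts are per evaluation of the rotation map. -}

module Defs where

open import Data.Nat.Base as ℕ using (ℕ; zero; suc; NonZero; ⌊_/2⌋; ⌈_/2⌉; _^_; s≤s)
import Data.Nat.Properties as ℕₚ
open import Data.Nat.Induction using (<-wellFounded)
open import Data.Nat.Logarithm using (⌊log₂_⌋)
open import Data.Integer.Base using (+_)
open import Data.Rational as ℚ using (ℚ; 0ℚ; 1ℚ; ½; ∣_∣)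
import Data.Rational.Properties as ℚₚ
open import Data.Fin.Base using (Fin; toℕ)
import Data.Fin.Properties as Finₚ
open import Data.Fin.Permutation using (cast-id)
open import Data.List.Base using (length; filter; cartesianProduct; allFin)
open import Data.Vec.Base using (Vec; []; _∷_; _++_; lookup; map; sum)
import Data.Vec.Functional as Vector
open import Data.Product using (_×_; _,_; proj₁; proj₂; ∃)
open import Data.Product.Properties using (≡-dec)
open import Data.Product.Function.NonDependent.Propositional using (_×-↔_)
open import Function.Base using (_∘_)
open import Function.Bundles using (_↔_; Inverse)
open import Function.Properties.Inverse using (↔-refl; ↔-sym; ↔-trans)
open import Relation.Nullary.Decidable.Core using (dec⇒maybe)
open import Tactic.RingSolver using (solve-∀)
open import Tactic.RingSolver.Core.AlmostCommutativeRing
  using (AlmostCommutativeRing; fromCommutativeRing)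
open import Level using (0ℓ)
open import Induction.WellFounded using (Acc; acc)
open import Relation.Binary.PropositionalEquality
  using (_≡_; refl; sym; trans; cong; cong₂; subst)

------------------------------------------------------------------------
-- Real numbers, as Cauchy sequences of rationals

-- Two sequences denote the same real number when they are related by _≈_ below.
record ℝ : Set where
  constructor mkℝ
  field
    seq    : ℕ → ℚ
    cauchy : ∀ ε → 0ℚ ℚ.< ε → ∃ λ N → ∀ m n → N ℕ.≤ m → N ℕ.≤ n →
             ∣ seq m ℚ.- seq n ∣ ℚ.< ε

open ℝ public

infix 4 _≤_ _<_ _≈_

_≤_ : ℝ → ℝ → Set
x ≤ y = ∀ ε → 0ℚ ℚ.< ε → ∃ λ N → ∀ n → N ℕ.≤ n → seq x n ℚ.≤ seq y n ℚ.+ ε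

_<_ : ℝ → ℝ → Set
x < y = ∃ λ ε → 0ℚ ℚ.< ε × ∃ λ N → ∀ n → N ℕ.≤ n → seq x n ℚ.+ ε ℚ.≤ seq y n

_≈_ : ℝ → ℝ → Set
x ≈ y = x ≤ y × y ≤ x

fromℚ : ℚ → ℝ
fromℚ q = mkℝ (λ _ → q) λ ε ε>0 →
  0 , λ _ _ _ _ → subst (λ z → ∣ z ∣ ℚ.< ε) (sym (ℚₚ.+-inverseʳ q)) ε>0

0ℝ : ℝ
0ℝ = fromℚ 0ℚ

1ℝ : ℝ
1ℝ = fromℚ 1ℚ

ℚ-ring : AlmostCommutativeRing 0ℓ 0ℓ
ℚ-ring = fromCommutativeRing ℚₚ.+-*-commutativeRing λ q → dec⇒maybe (0ℚ ℚₚ.≟ q)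

-- Only the statements of these lemmas matter below.
abstract
  half-pos : ∀ ε → 0ℚ ℚ.< ε → 0ℚ ℚ.< ½ ℚ.* ε
  half-pos ε ε>0 =
    subst (ℚ._< ½ ℚ.* ε) (ℚₚ.*-zeroʳ ½) (ℚₚ.*-monoʳ-<-pos ½ ε>0)

  halves : ∀ ε → ½ ℚ.* ε ℚ.+ ½ ℚ.* ε ≡ ε
  halves ε = trans (sym (ℚₚ.*-distribʳ-+ ε ½ ½)) (ℚₚ.*-identityˡ ε)

  +-cauchy : ∀ x y ε → 0ℚ ℚ.< ε → ∃ λ N → ∀ m n → N ℕ.≤ m → N ℕ.≤ n →
    ∣ (seq x m ℚ.+ seq y m) ℚ.- (seq x n ℚ.+ seq y n) ∣ ℚ.< ε
  +-cauchy x y ε ε>0 =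
    let (N₁ , p) = cauchy x (½ ℚ.* ε) (half-pos ε ε>0)
        (N₂ , q) = cauchy y (½ ℚ.* ε) (half-pos ε ε>0)
    in N₁ ℕ.⊔ N₂ , λ m n N≤m N≤n →
      let open ℚₚ.≤-Reasoning
          a = seq x m ; b = seq y m ; c = seq x n ; d = seq y n
      in begin-strict
        ∣ (a ℚ.+ b) ℚ.- (c ℚ.+ d) ∣      ≡⟨ cong ∣_∣ (rearrange a b c d) ⟩
        ∣ (a ℚ.- c) ℚ.+ (b ℚ.- d) ∣      ≤⟨ ℚₚ.∣p+q∣≤∣p∣+∣q∣ (a ℚ.- c) (b ℚ.- d) ⟩
        ∣ a ℚ.- c ∣ ℚ.+ ∣ b ℚ.- d ∣      <⟨ ℚₚ.+-mono-<
          (p m n (ℕₚ.m⊔n≤o⇒m≤o N₁ N₂ N≤m) (ℕₚ.m⊔n≤o⇒m≤o N₁ N₂ N≤n))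
          (q m n (ℕₚ.m⊔n≤o⇒n≤o N₁ N₂ N≤m) (ℕₚ.m⊔n≤o⇒n≤o N₁ N₂ N≤n)) ⟩
        ½ ℚ.* ε ℚ.+ ½ ℚ.* ε              ≡⟨ halves ε ⟩
        ε                                ∎
    where
    rearrange : ∀ a b c d → (a ℚ.+ b) ℚ.- (c ℚ.+ d) ≡ (a ℚ.- c) ℚ.+ (b ℚ.- d)
    rearrange = solve-∀ ℚ-ring

  eventually-bounded : ∀ x → ∃ λ B → 0ℚ ℚ.< B × ∃ λ N → ∀ n → N ℕ.≤ n → ∣ seq x n ∣ ℚ.< B
  eventually-bounded x =
    let (N , p) = cauchy x 1ℚ (ℚₚ.positive⁻¹ 1ℚ)
        c = seq x N
        open ℚₚ.≤-Reasoning
        bound : ∀ n → N ℕ.≤ n → ∣ seq x n ∣ ℚ.< 1ℚ ℚ.+ ∣ c ∣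
        bound n N≤n = begin-strict
          ∣ seq x n ∣                       ≡⟨ cong ∣_∣ (split (seq x n) c) ⟩
          ∣ (seq x n ℚ.- c) ℚ.+ c ∣         ≤⟨ ℚₚ.∣p+q∣≤∣p∣+∣q∣ (seq x n ℚ.- c) c ⟩
          ∣ seq x n ℚ.- c ∣ ℚ.+ ∣ c ∣       <⟨ ℚₚ.+-monoˡ-< ∣ c ∣ (p n N N≤n ℕₚ.≤-refl) ⟩
          1ℚ ℚ.+ ∣ c ∣                      ∎
    in 1ℚ ℚ.+ ∣ c ∣
     , ℚₚ.+-mono-<-≤ (ℚₚ.positive⁻¹ 1ℚ) (ℚₚ.0≤∣p∣ c)
     , N , bound
    where
    split : ∀ a c → a ≡ (a ℚ.- c) ℚ.+ c
    split = solve-∀ ℚ-ring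

  -- For B > 0 and η > 0, a δ > 0 with B * δ = η.
  divide : ∀ B η → 0ℚ ℚ.< B → 0ℚ ℚ.< η → ∃ λ δ → 0ℚ ℚ.< δ × B ℚ.* δ ≡ η
  divide B η B>0 η>0 = B⁻¹ ℚ.* η , pos , eq
    where
    instance
      B-pos : ℚ.Positive B
      B-pos = ℚ.positive B>0
      B-nonZero : ℚ.NonZero B
      B-nonZero = ℚₚ.pos⇒nonZero B
    B⁻¹ : ℚ
    B⁻¹ = ℚ.1/ B
    pos : 0ℚ ℚ.< B⁻¹ ℚ.* η
    pos = subst (ℚ._< B⁻¹ ℚ.* η) (ℚₚ.*-zeroʳ B⁻¹)
      (ℚₚ.*-monoʳ-<-pos B⁻¹ {{ℚₚ.1/pos⇒pos B}} η>0)
    eq : B ℚ.* (B⁻¹ ℚ.* η) ≡ η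
    eq = trans (sym (ℚₚ.*-assoc B B⁻¹ η))
      (trans (cong (ℚ._* η) (ℚₚ.*-inverseʳ B)) (ℚₚ.*-identityˡ η))

  ∣*∣≤ : ∀ a b {B δ} → ∣ a ∣ ℚ.< B → ∣ b ∣ ℚ.< δ → ∣ a ℚ.* b ∣ ℚ.≤ B ℚ.* δ
  ∣*∣≤ a b {B} {δ} a<B b<δ = begin
    ∣ a ℚ.* b ∣        ≡⟨ ℚₚ.∣p*q∣≡∣p∣*∣q∣ a b ⟩
    ∣ a ∣ ℚ.* ∣ b ∣    ≤⟨ ℚₚ.*-monoʳ-≤-nonNeg ∣ b ∣ {{ℚₚ.∣-∣-nonNeg b}} (ℚₚ.<⇒≤ a<B) ⟩
    B ℚ.* ∣ b ∣        ≤⟨ ℚₚ.*-monoˡ-≤-nonNeg B {{ℚ.nonNegative 0≤B}} (ℚₚ.<⇒≤ b<δ) ⟩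
    B ℚ.* δ            ∎
    where
    open ℚₚ.≤-Reasoning
    0≤B : 0ℚ ℚ.≤ B
    0≤B = ℚₚ.≤-trans (ℚₚ.0≤∣p∣ a) (ℚₚ.<⇒≤ a<B)

  *-cauchy : ∀ x y ε → 0ℚ ℚ.< ε → ∃ λ N → ∀ m n → N ℕ.≤ m → N ℕ.≤ n →
    ∣ seq x m ℚ.* seq y m ℚ.- seq x n ℚ.* seq y n ∣ ℚ.< ε
  *-cauchy x y ε ε>0 =
    let η         = ½ ℚ.* ε
        η>0       = half-pos ε ε>0
        ζ         = ½ ℚ.* η
        ζ>0       = half-pos η η>0
        ζ<η       = subst (ζ ℚ.<_) (halves η) (subst (ℚ._< ζ ℚ.+ ζ) (ℚₚ.+-identityʳ ζ)
                      (ℚₚ.+-monoʳ-< ζ ζ>0))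
        (A , A>0 , N₁ , p₁)     = eventually-bounded x
        (B , B>0 , N₂ , p₂)     = eventually-bounded y
        (δ₁ , δ₁>0 , Aδ₁≡ζ)     = divide A ζ A>0 ζ>0
        (δ₂ , δ₂>0 , Bδ₂≡ζ)     = divide B ζ B>0 ζ>0
        (N₃ , q₁) = cauchy y δ₁ δ₁>0
        (N₄ , q₂) = cauchy x δ₂ δ₂>0
        N₁₂ = N₁ ℕ.⊔ N₂
        N₃₄ = N₃ ℕ.⊔ N₄
        below : ∀ {k} → N₁₂ ℕ.⊔ N₃₄ ℕ.≤ k →
                (N₁ ℕ.≤ k × N₂ ℕ.≤ k) × (N₃ ℕ.≤ k × N₄ ℕ.≤ k)
        below = λ le →
          let l = ℕₚ.m⊔n≤o⇒m≤o N₁₂ N₃₄ le ; r = ℕₚ.m⊔n≤o⇒n≤o N₁₂ N₃₄ le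
          in (ℕₚ.m⊔n≤o⇒m≤o N₁ N₂ l , ℕₚ.m⊔n≤o⇒n≤o N₁ N₂ l)
           , (ℕₚ.m⊔n≤o⇒m≤o N₃ N₄ r , ℕₚ.m⊔n≤o⇒n≤o N₃ N₄ r)
    in N₁₂ ℕ.⊔ N₃₄ , λ m n N≤m N≤n →
      let a = seq x m ; b = seq y m ; c = seq x n ; d = seq y n
          ((N₁≤m , _) , (N₃≤m , N₄≤m)) = below N≤m
          ((_ , N₂≤n) , (N₃≤n , N₄≤n)) = below N≤n
          open ℚₚ.≤-Reasoning
      in begin-strict
        ∣ a ℚ.* b ℚ.- c ℚ.* d ∣
          ≡⟨ cong ∣_∣ (rearrange a b c d) ⟩
        ∣ a ℚ.* (b ℚ.- d) ℚ.+ d ℚ.* (a ℚ.- c) ∣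
          ≤⟨ ℚₚ.∣p+q∣≤∣p∣+∣q∣ (a ℚ.* (b ℚ.- d)) (d ℚ.* (a ℚ.- c)) ⟩
        ∣ a ℚ.* (b ℚ.- d) ∣ ℚ.+ ∣ d ℚ.* (a ℚ.- c) ∣
          ≤⟨ ℚₚ.+-mono-≤ (∣*∣≤ a (b ℚ.- d) (p₁ m N₁≤m) (q₁ m n N₃≤m N₃≤n))
                         (∣*∣≤ d (a ℚ.- c) (p₂ n N₂≤n) (q₂ m n N₄≤m N₄≤n)) ⟩
        A ℚ.* δ₁ ℚ.+ B ℚ.* δ₂
          ≡⟨ cong₂ ℚ._+_ Aδ₁≡ζ Bδ₂≡ζ ⟩
        ζ ℚ.+ ζ
          <⟨ ℚₚ.+-mono-< ζ<η ζ<η ⟩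
        η ℚ.+ η
          ≡⟨ halves ε ⟩
        ε ∎
    where
    rearrange : ∀ a b c d →
      a ℚ.* b ℚ.- c ℚ.* d ≡ a ℚ.* (b ℚ.- d) ℚ.+ d ℚ.* (a ℚ.- c)
    rearrange = solve-∀ ℚ-ring

infixl 6 _+_
infixl 7 _*_

_+_ : ℝ → ℝ → ℝ
x + y = mkℝ (λ n → seq x n ℚ.+ seq y n) (+-cauchy x y)

_*_ : ℝ → ℝ → ℝ
x * y = mkℝ (λ n → seq x n ℚ.* seq y n) (*-cauchy x y)

Σℝ : ∀ {n : ℕ} → (Fin n → ℝ) → ℝ
Σℝ = Vector.foldr _+_ 0ℝ

------------------------------------------------------------------------
-- Regular graphs given by rotation maps

-- V is the set of vertices and L the set of edge labels.
record Graph (V L : Set) : Set where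
  field
    rot        : V × L → V × L
    involutive : ∀ e → rot (rot e) ≡ e

open Graph public

-- Renaming of vertices and edge labels.
reindex : {V V′ L L′ : Set} → V ↔ V′ → L ↔ L′ → Graph V L → Graph V′ L′
reindex {V} {V′} {L} {L′} f g G = record
  { rot        = λ e → to (rot G (from e))
  ; involutive = λ e →
      trans (cong (to ∘ rot G) (strictlyInverseʳ (rot G (from e))))
        (trans (cong to (involutive G (from e))) (strictlyInverseˡ e))
  }
  where
  iso : (V × L) ↔ (V′ × L′)
  iso = f ×-↔ g
  open Inverse iso

square : {V L : Set} → Graph V L → Graph V (L × L)
square {V} {L} G = record { rot = rot² ; involutive = inv }
  where
  rot² : V × (L × L) → V × (L × L)
  rot² (v₀ , (k₁ , k₂)) =
    let (v₁ , ℓ₁) = rot G (v₀ , k₁)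
        (v₂ , ℓ₂) = rot G (v₁ , k₂)
    in (v₂ , (ℓ₂ , ℓ₁))

  inv : ∀ e → rot² (rot² e) ≡ e
  inv (v₀ , (k₁ , k₂))
    rewrite involutive G (proj₁ (rot G (v₀ , k₁)) , k₂)
          | involutive G (v₀ , k₁) = refl

infixr 7 _⊗_

_⊗_ : {V₁ V₂ L₁ L₂ : Set} → Graph V₁ L₁ → Graph V₂ L₂ → Graph (V₁ × V₂) (L₁ × L₂)
_⊗_ {V₁} {V₂} {L₁} {L₂} G₁ G₂ = record { rot = rot⊗ ; involutive = inv }
  where
  rot⊗ : (V₁ × V₂) × (L₁ × L₂) → (V₁ × V₂) × (L₁ × L₂)
  rot⊗ ((v , w) , (i , j)) =
    let (v′ , i′) = rot G₁ (v , i)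
        (w′ , j′) = rot G₂ (w , j)
    in ((v′ , w′) , (i′ , j′))

  inv : ∀ e → rot⊗ (rot⊗ e) ≡ e
  inv ((v , w) , (i , j))
    rewrite involutive G₁ (v , i) | involutive G₂ (w , j) = refl

-- The edge labels of the large graph are the vertices of the small one.
zigzag : {V K L : Set} → Graph V K → Graph K L → Graph (V × K) (L × L)
zigzag {V} {K} {L} G₁ G₂ = record { rot = rotz ; involutive = inv }
  where
  rotz : (V × K) × (L × L) → (V × K) × (L × L)
  rotz ((v , k) , (i , j)) =
    let (k′ , i′) = rot G₂ (k , i)
        (w , ℓ′)  = rot G₁ (v , k′)
        (ℓ , j′)  = rot G₂ (ℓ′ , j)
    in ((w , ℓ) , (j′ , i′))

  inv : ∀ e → rotz (rotz e) ≡ e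
  inv ((v , k) , (i , j))
    rewrite involutive G₂ (proj₂ (rot G₁ (v , proj₁ (rot G₂ (k , i)))) , j)
          | involutive G₁ (v , proj₁ (rot G₂ (k , i)))
          | involutive G₂ (k , i) = refl

------------------------------------------------------------------------
-- Spectral expansion

module _ {N D : ℕ} (G : Graph (Fin N) (Fin D)) where

  -- The number of pairs (i , j) with Rot (u , i) = (v , j).
  edges : Fin N → Fin N → ℕ
  edges u v = length (filter
    (λ (i , j) → ≡-dec Finₚ._≟_ Finₚ._≟_ (rot G (u , i)) (v , j))
    (cartesianProduct (allFin D) (allFin D)))

  adjacency : .{{NonZero D}} → Fin N → Fin N → ℝ
  adjacency u v = fromℚ ((+ edges u v) ℚ./ D)

⟨_,_⟩ : {N : ℕ} → (Fin N → ℝ) → (Fin N → ℝ) → ℝ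
⟨ α , β ⟩ = Σℝ λ i → α i * β i

‖_‖² : {N : ℕ} → (Fin N → ℝ) → ℝ
‖ α ‖² = ⟨ α , α ⟩

𝟙 : {N : ℕ} → Fin N → ℝ
𝟙 _ = 1ℝ

_·_ : {N : ℕ} → (Fin N → Fin N → ℝ) → (Fin N → ℝ) → Fin N → ℝ
(M · α) u = Σℝ λ v → M u v * α v

-- λ(G) ≤ μ.  The bound on the maximum says ‖Mα‖ ≤ μ‖α‖ for all α ⊥ 𝟙, with both
-- (nonnegative) sides squared below.  Nonnegativity of μ matters on its own
-- only when N = 1, where λ(G) = 0 by convention.
IsExpander : {N D : ℕ} .{{_ : NonZero D}} → Graph (Fin N) (Fin D) → ℝ → Set
IsExpander {N} G μ =
  0ℝ ≤ μ ×
  (∀ (α : Fin N → ℝ) → ⟨ α , 𝟙 ⟩ ≈ 0ℝ → ‖ adjacency G · α ‖² ≤ (μ * μ) * ‖ α ‖²)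

------------------------------------------------------------------------
-- The recursive family

-- Pairs (i , j) are numbered as i * n + j.
pairs : {m n k : ℕ} → .(m ℕ.* n ≡ k) → (Fin m × Fin n) ↔ Fin k
pairs eq = ↔-trans (↔-sym Finₚ.*↔×) (cast-id eq)

^-+ : ∀ D a b → (D ^ a) ℕ.* (D ^ b) ≡ D ^ (a ℕ.+ b)
^-+ D a b = sym (ℕₚ.^-distribˡ-+-* D a b)

D*D≡D² : ∀ D → D ℕ.* D ≡ D ^ 2
D*D≡D² D = cong (D ℕ.*_) (sym (ℕₚ.*-identityʳ D))

vertices-eq : ∀ D t → let a = ⌈ suc t /2⌉ ; b = ⌊ suc t /2⌋ in
  ((D ^ (8 ℕ.* a)) ℕ.* (D ^ (8 ℕ.* b))) ℕ.* (D ^ 8) ≡ D ^ (8 ℕ.* suc (suc t))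
vertices-eq D t =
  trans (cong (ℕ._* (D ^ 8)) (^-+ D (8 ℕ.* a) (8 ℕ.* b)))
    (trans (^-+ D (8 ℕ.* a ℕ.+ 8 ℕ.* b) 8) (cong (D ^_) exponent))
  where
  a b : ℕ
  a = ⌈ suc t /2⌉
  b = ⌊ suc t /2⌋
  exponent : (8 ℕ.* a ℕ.+ 8 ℕ.* b) ℕ.+ 8 ≡ 8 ℕ.* suc (suc t)
  exponent =
    trans (cong (ℕ._+ 8) (sym (ℕₚ.*-distribˡ-+ 8 a b)))
      (trans (cong (λ s → 8 ℕ.* s ℕ.+ 8)
               (trans (ℕₚ.+-comm a b) (ℕₚ.⌊n/2⌋+⌈n/2⌉≡n (suc t))))
        (trans (ℕₚ.+-comm (8 ℕ.* suc t) 8) (sym (ℕₚ.*-suc 8 (suc t)))))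

-- The three shapes of member of the family, with vertices and edge labels renumbered.
squareOf : {M D E : ℕ} → .(D ℕ.* D ≡ E) → Graph (Fin M) (Fin D) → Graph (Fin M) (Fin E)
squareOf eqE H = reindex ↔-refl (pairs eqE) (square H)

tensorSquareOf : {M D E V : ℕ} → .(D ℕ.* D ≡ E) → .(M ℕ.* M ≡ V) →
  Graph (Fin M) (Fin D) → Graph (Fin V) (Fin E)
tensorSquareOf eqE eqV H = reindex (pairs eqV) (pairs eqE) (H ⊗ H)

zigzagOf : {M D E F A B V : ℕ} →
  .(D ℕ.* D ≡ E) → .(E ℕ.* E ≡ F) → .(F ℕ.* F ≡ M) → .((A ℕ.* B) ℕ.* M ≡ V) →
  Graph (Fin A) (Fin E) → Graph (Fin B) (Fin E) → Graph (Fin M) (Fin D) →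
  Graph (Fin V) (Fin E)
zigzagOf {M} {D} {E} {F} {A} {B} {V} eqE eqF eqM eqV Gₐ G_b H =
  reindex vertices (pairs eqE) (zigzag (reindex ↔-refl labels (square (Gₐ ⊗ G_b))) H)
  where
  vertices : ((Fin A × Fin B) × Fin M) ↔ Fin V
  vertices = ↔-trans (pairs refl ×-↔ ↔-refl) (pairs eqV)
  labels : ((Fin E × Fin E) × (Fin E × Fin E)) ↔ Fin M
  labels = ↔-trans (pairs eqF ×-↔ pairs eqF) (pairs eqM)

module _ {D : ℕ} (H : Graph (Fin (D ^ 8)) (Fin D)) where

  familyAcc : (t : ℕ) → .{{NonZero t}} → Acc ℕ._<_ t →
    Graph (Fin (D ^ (8 ℕ.* t))) (Fin (D ^ 2))
  familyAcc 1 _ = squareOf (D*D≡D² D) H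
  familyAcc 2 _ = tensorSquareOf (D*D≡D² D) (^-+ D 8 8) H
  -- Here t = 3 + s, so the halves of t - 1 are those of 2 + s.
  familyAcc (suc (suc (suc s))) (acc rs) =
    zigzagOf (D*D≡D² D) (^-+ D 2 2) (^-+ D 4 4) (vertices-eq D (suc s))
      (familyAcc ⌈ suc (suc s) /2⌉ (rs (ℕₚ.m<n⇒m<1+n (ℕₚ.⌈n/2⌉<n s))))
      (familyAcc ⌊ suc (suc s) /2⌋ (rs (ℕₚ.m<n⇒m<1+n (ℕₚ.⌊n/2⌋<n (suc s)))))
      H

  family : (t : ℕ) → .{{NonZero t}} → Graph (Fin (D ^ (8 ℕ.* t))) (Fin (D ^ 2))
  family t = familyAcc t (<-wellFounded t)

------------------------------------------------------------------------
-- Oracle algorithms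
--
-- Programs consist of finitely many first-order, mutually recursive
-- procedures over natural numbers, with the instructions and the logarithmic
-- cost of a random access machine: handling a number costs its length in
-- binary.  Running time is therefore polynomially related to that of Turing
-- machines.

size : ℕ → ℕ
size n = suc ⌊log₂ n ⌋

sizes : {n : ℕ} → Vec ℕ n → ℕ
sizes xs = sum (map size xs)

data Op : Set where
  add sub mul div : Op

-- Subtraction is truncated, and division by zero gives zero.
apply : Op → ℕ → ℕ → ℕ
apply add m n       = m ℕ.+ n
apply sub m n       = m ℕ.∸ n
apply mul m n       = m ℕ.* n
apply div m zero    = zero
apply div m (suc n) = m ℕ./ suc n

-- Code sig n m: code with n variables in scope returning m numbers; procedure
-- f takes proj₁ (sig f) arguments and returns proj₂ (sig f) numbers.
data Code {P : ℕ} (sig : Fin P → ℕ × ℕ) (n : ℕ) : ℕ → Set where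
  ret   : {m : ℕ} → Vec (Fin n) m → Code sig n m
  const : ℕ → Code sig n 1
  arith : Op → Fin n → Fin n → Code sig n 1
  query : Fin n → Fin n → Code sig n 2
  call  : (f : Fin P) → Vec (Fin n) (proj₁ (sig f)) → Code sig n (proj₂ (sig f))
  bind  : {k m : ℕ} → Code sig n k → Code sig (k ℕ.+ n) m → Code sig n m
  ifz   : {m : ℕ} → Fin n → Code sig n m → Code sig n m → Code sig n m

record Program (ins outs : ℕ) : Set where
  field
    procedures : ℕ
    sig        : Fin procedures → ℕ × ℕ
    body       : (f : Fin procedures) → Code sig (proj₁ (sig f)) (proj₂ (sig f))
    main       : Code sig ins outs

module _ {ins outs N D : ℕ} (p : Program ins outs) (H : Graph (Fin N) (Fin D)) where

  open Program p

  -- Eval ρ c ys T Q: in environment ρ the code c returns ys after T time steps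
  -- and Q oracle queries.  The oracle answers only queries in the domain of
  -- Rot_H, whose elements are represented by their values as numbers.
  data Eval {n : ℕ} (ρ : Vec ℕ n) : {m : ℕ} → Code sig n m → Vec ℕ m → ℕ → ℕ → Set where
    ret   : ∀ {m} (xs : Vec (Fin n) m) →
            let ys = map (lookup ρ) xs in
            Eval ρ (ret xs) ys (suc (sizes ys)) 0
    const : ∀ c → Eval ρ (const c) (c ∷ []) (size c) 0
    arith : ∀ o x y →
            Eval ρ (arith o x y) (apply o (lookup ρ x) (lookup ρ y) ∷ [])
              (size (lookup ρ x) ℕ.+ size (lookup ρ y)) 0
    query : ∀ {x y} (v : Fin N) (i : Fin D) →
            lookup ρ x ≡ toℕ v → lookup ρ y ≡ toℕ i →
            let (w , j) = rot H (v , i) in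
            Eval ρ (query x y) (toℕ w ∷ toℕ j ∷ []) 1 1
    call  : ∀ {f xs ys T Q} →
            let args = map (lookup ρ) xs in
            Eval args (body f) ys T Q →
            Eval ρ (call f xs) ys (suc (sizes args ℕ.+ T)) Q
    bind  : ∀ {k m} {c : Code sig n k} {d : Code sig (k ℕ.+ n) m} {ys zs T T′ Q Q′} →
            Eval ρ c ys T Q → Eval (ys ++ ρ) d zs T′ Q′ →
            Eval ρ (bind c d) zs (T ℕ.+ T′) (Q ℕ.+ Q′)
    ifz-0 : ∀ {m x} {c d : Code sig n m} {ys T Q} →
            lookup ρ x ≡ 0 → Eval ρ c ys T Q →
            Eval ρ (ifz x c d) ys (size (lookup ρ x) ℕ.+ T) Q
    ifz-s : ∀ {m x} {c d : Code sig n m} {ys T Q} →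
            NonZero (lookup ρ x) → Eval ρ d ys T Q →
            Eval ρ (ifz x c d) ys (size (lookup ρ x) ℕ.+ T) Q

  Runs : Vec ℕ ins → Vec ℕ outs → ℕ → ℕ → Set
  Runs inputs = Eval inputs main

{-# OPTIONS --safe #-}

-- A bound λ(G) ≤ q says that a step of the random walk on G shrinks the
-- variance of every function by a factor q².  For a zig-zag product, split a
-- function into its means over the clouds and a remainder of mean zero on
-- every cloud: with bounds m for the large graph and l for the small one,
-- where l² ≤ m, the means are contracted by m, the remainder by l² ≤ m, and
-- what passes from one part to the other by l, which gives m + l.  Here the
-- large graph is a square, so a bound r for its tensor factors gives m = r².
-- With r = q + 5 q² and q ≤ 1/5 one has r² ≤ 5 q², so the bound r reproduces
-- itself; for q > 1/5 the trivial bound 1 is below 25 q².  Hence C = 25.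
--
-- These estimates are made for rational q ≥ μ, where the order is decidable;
-- the bound at μ itself follows by letting q tend to μ.
--
-- The algorithm unfolds the recursion.  A call for t makes two calls for each
-- of the two halves of t - 1, so there are O(t²) calls, on numbers of
-- O(t log D) bits.

module Submission where

open import Defs hiding (_+_; _*_; _≤_; _<_; _≈_)
open import Data.Nat.Base as ℕ using (ℕ; zero; suc; NonZero; _^_; z≤n; s≤s)
import Data.Nat.Properties as ℕₚ
open import Data.Nat.Properties using (m^n≢0)
open import Data.Nat.DivMod using (_/_; m*n/n≡m; m<n⇒m/n≡0; +-distrib-/-∣ˡ)
open import Data.Nat.Divisibility using (divides)
open import Data.Nat.Induction using (<-wellFounded)
open import Data.Nat.Logarithm using (⌊log₂_⌋; ⌊log₂⌋-mono-≤; ⌊log₂[2^n]⌋≡n)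
open import Data.Nat.Solver using (module +-*-Solver)
open import Data.Nat.Tactic.RingSolver using () renaming (solve-∀ to solve-ℕ)
open import Data.Integer.Base as ℤ using (+_)
import Data.Integer.Properties as ℤₚ
open import Data.Integer.Tactic.RingSolver using () renaming (solve-∀ to solve-ℤ)
open import Data.Rational as ℚ using (ℚ; 0ℚ; 1ℚ; ½; ∣_∣)
import Data.Rational.Properties as ℚₚ
open import Data.Rational.Unnormalised.Base as ℚᵘ using (mkℚᵘ; *≡*)
import Data.Rational.Unnormalised.Properties as ℚᵘₚ
open import Data.Bool.Base using (if_then_else_; true; false)
open import Data.Fin using (#_)
open import Data.Fin.Base using (Fin; toℕ; zero; suc; _↑ˡ_; _↑ʳ_; combine; remQuot)
open import Data.Fin.Patterns using (0F; 1F; 2F; 3F; 4F; 5F; 6F; 7F)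
open import Data.Fin.Permutation using (↔⇒≡)
import Data.Fin.Properties as Finₚ
open import Data.List.Base as List using (List; []; _∷_; length; filter; cartesianProduct; tabulate; allFin)
open import Data.Product using (∃; Σ-syntax; _×_; _,_; proj₁; proj₂; swap)
open import Data.Product.Function.NonDependent.Propositional using (_×-↔_)
open import Data.Product.Properties using (≡-dec; ,-injectiveˡ; ,-injectiveʳ)
open import Data.Sum using (inj₁; inj₂)
open import Data.Vec.Base as Vec using (Vec; []; _∷_; lookup)
open import Data.Vec.Relation.Unary.All using (All; []; _∷_)
import Data.Vec.Relation.Unary.All.Properties as Allₚ
open import Algebra.Bundles using (CommutativeRing)
open import Algebra.Properties.Semiring.Sum (CommutativeRing.semiring ℚₚ.+-*-commutativeRing)
  using (sum; sum-cong-≗; ∑-distrib-+; ∑-comm; sum-permute; *-distribˡ-sum; *-distribʳ-sum; sum-replicate-zero)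
open import Function.Base using (_∘_; it)
open import Function.Bundles using (_↔_; Inverse; mk↔ₛ′)
open import Function.Properties.Inverse using (↔-refl; ↔-sym; ↔-trans)
open import Induction.WellFounded using (Acc; acc)
open import Relation.Binary.PropositionalEquality
  using (_≡_; _≢_; refl; sym; trans; cong; cong₂; subst; subst₂; module ≡-Reasoning)
open import Relation.Nullary.Decidable using (does; dec-true; dec-false; recompute)
open import Relation.Unary using (Decidable)
open import Tactic.RingSolver using (solve-∀)
open +-*-Solver using (Polynomial; ⟦_⟧; con; var; _:+_; _:*_)

-- There are two reasons for variances in place of norms. Norms need square roots, which leave the
-- rationals. And a variance ignores constants, so the bounds hold for all rational functions and no
-- orthogonality has to be carried through the products. The price is the triangle inequality: it
-- becomes the weighted `m l Var (f + g) ≤ (m + l) (l Var f + m Var g)`, and cancelling `m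
-- l` at the end requires `0 < l`. On the way back to real vectors, orthogonality to `𝟙` holds only
-- in the limit: the coordinate sum of a rational approximation is merely small. The square of that
-- sum is an extra error that the limit has to absorb.

module Averages where

  open import Data.Rational using (_+_; _*_; _≤_)
  open Inverse using (to; from; strictlyInverseʳ)

  -- Fractions with a fixed denominator and finite rational sums.

  recip : ∀ n → .{{NonZero n}} → ℚ
  recip n = (+ 1) ℚ./ n

  -- Normalised fractions are reduced by a gcd, which does not compute for variables. On
  -- unnormalised representatives the claim is an identity of integers.
  /-suc : ∀ e d .{{_ : NonZero d}} → (+ suc e) ℚ./ d ≡ recip d + (+ e) ℚ./ d
  /-suc e (suc d) = ℚₚ.toℚᵘ-injective (begin
    ℚ.toℚᵘ (ℚ.fromℚᵘ (mkℚᵘ (+ suc e) d))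
      ≈⟨ ℚₚ.toℚᵘ-fromℚᵘ (mkℚᵘ (+ suc e) d) ⟩
    mkℚᵘ (+ suc e) d
      ≈⟨ *≡* (numerators (+ e) (+ suc d)) ⟩
    mkℚᵘ (+ 1) d ℚᵘ.+ mkℚᵘ (+ e) d
      ≈⟨ ℚᵘₚ.+-cong (ℚₚ.toℚᵘ-fromℚᵘ (mkℚᵘ (+ 1) d)) (ℚₚ.toℚᵘ-fromℚᵘ (mkℚᵘ (+ e) d)) ⟨
    ℚ.toℚᵘ (ℚ.fromℚᵘ (mkℚᵘ (+ 1) d)) ℚᵘ.+ ℚ.toℚᵘ (ℚ.fromℚᵘ (mkℚᵘ (+ e) d))
      ≈⟨ ℚₚ.toℚᵘ-homo-+ (ℚ.fromℚᵘ (mkℚᵘ (+ 1) d)) (ℚ.fromℚᵘ (mkℚᵘ (+ e) d)) ⟨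
    ℚ.toℚᵘ (ℚ.fromℚᵘ (mkℚᵘ (+ 1) d) + ℚ.fromℚᵘ (mkℚᵘ (+ e) d)) ∎)
    where
    open ℚᵘₚ.≃-Reasoning
    numerators : ∀ e d → (+ 1 ℤ.+ e) ℤ.* (d ℤ.* d) ≡ (+ 1 ℤ.* d ℤ.+ e ℤ.* d) ℤ.* d
    numerators = solve-ℤ

  /-self : ∀ d .{{_ : NonZero d}} → (+ d) ℚ./ d ≡ 1ℚ
  /-self (suc d) = ℚₚ.toℚᵘ-injective (ℚᵘₚ.≃-trans (ℚₚ.toℚᵘ-fromℚᵘ (mkℚᵘ (+ suc d) d))
    (*≡* (ℤₚ.*-comm (+ suc d) (+ 1))))

  0/ : ∀ d .{{_ : NonZero d}} → (+ 0) ℚ./ d ≡ 0ℚ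
  0/ (suc d) = ℚₚ.toℚᵘ-injective (ℚᵘₚ.≃-trans (ℚₚ.toℚᵘ-fromℚᵘ (mkℚᵘ (+ 0) d)) (*≡* refl))

  recip-* : ∀ m n .{{_ : NonZero m}} .{{_ : NonZero n}} →
    recip m * recip n ≡ recip (m ℕ.* n) {{ℕₚ.m*n≢0 m n}}
  recip-* (suc m) (suc n) = ℚₚ.toℚᵘ-injective (begin
    ℚ.toℚᵘ (ℚ.fromℚᵘ (mkℚᵘ (+ 1) m) * ℚ.fromℚᵘ (mkℚᵘ (+ 1) n))
      ≈⟨ ℚₚ.toℚᵘ-homo-* (ℚ.fromℚᵘ (mkℚᵘ (+ 1) m)) (ℚ.fromℚᵘ (mkℚᵘ (+ 1) n)) ⟩
    ℚ.toℚᵘ (ℚ.fromℚᵘ (mkℚᵘ (+ 1) m)) ℚᵘ.* ℚ.toℚᵘ (ℚ.fromℚᵘ (mkℚᵘ (+ 1) n))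
      ≈⟨ ℚᵘₚ.*-cong (ℚₚ.toℚᵘ-fromℚᵘ (mkℚᵘ (+ 1) m)) (ℚₚ.toℚᵘ-fromℚᵘ (mkℚᵘ (+ 1) n)) ⟩
    mkℚᵘ (+ 1) (n ℕ.+ m ℕ.* suc n)
      ≈⟨ ℚₚ.toℚᵘ-fromℚᵘ (mkℚᵘ (+ 1) (n ℕ.+ m ℕ.* suc n)) ⟨
    ℚ.toℚᵘ (ℚ.fromℚᵘ (mkℚᵘ (+ 1) (n ℕ.+ m ℕ.* suc n))) ∎)
    where open ℚᵘₚ.≃-Reasoning

  sum-recip : ∀ n d .{{_ : NonZero d}} → sum {n} (λ _ → recip d) ≡ (+ n) ℚ./ d
  sum-recip zero    d = sym (0/ d)
  sum-recip (suc n) d = trans (cong (λ z → recip d + z) (sum-recip n d)) (sym (/-suc n d))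

  0≤recip : ∀ d .{{_ : NonZero d}} → 0ℚ ≤ recip d
  0≤recip (suc d) = ℚₚ.toℚᵘ-cancel-≤ (ℚᵘₚ.≤-respʳ-≃
    (ℚᵘₚ.≃-sym (ℚₚ.toℚᵘ-fromℚᵘ (mkℚᵘ (+ 1) d))) (ℚᵘ.*≤* (ℤ.+≤+ z≤n)))

  sum-mono : ∀ {n} {f g : Fin n → ℚ} → (∀ i → f i ≤ g i) → sum f ≤ sum g
  sum-mono {zero}  f≤g = ℚₚ.≤-refl
  sum-mono {suc n} f≤g = ℚₚ.+-mono-≤ (f≤g zero) (sum-mono (f≤g ∘ suc))

  sum-zero : ∀ {n} (f : Fin n → ℚ) → (∀ i → f i ≡ 0ℚ) → sum f ≡ 0ℚ
  sum-zero {n} f f≡0 = trans (sum-cong-≗ f≡0) (sum-replicate-zero n)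

  0≤sum : ∀ {n} {f : Fin n → ℚ} → (∀ i → 0ℚ ≤ f i) → 0ℚ ≤ sum f
  0≤sum {n} {f} 0≤f = subst (_≤ sum f) (sum-replicate-zero n) (sum-mono {n} {λ _ → 0ℚ} 0≤f)

  sum-↑ : ∀ m {n} (f : Fin (m ℕ.+ n) → ℚ) →
    sum f ≡ sum (λ i → f (i ↑ˡ n)) + sum (λ j → f (m ↑ʳ j))
  sum-↑ zero    f = sym (ℚₚ.+-identityˡ (sum f))
  sum-↑ (suc m) f = trans (cong (λ z → f zero + z) (sum-↑ m (f ∘ suc)))
    (sym (ℚₚ.+-assoc (f zero) _ _))

  sum-combine : ∀ m {n} (f : Fin (m ℕ.* n) → ℚ) →
    sum f ≡ sum λ i → sum λ j → f (combine {m} i j)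
  sum-combine zero    f = refl
  sum-combine (suc m) {n} f =
    trans (sum-↑ n f) (cong (λ z → sum (λ j → f (j ↑ˡ (m ℕ.* n))) + z) (sum-combine m (λ k → f (n ↑ʳ k))))

  -- Averages over finite nonempty sets.

  record Finite (A : Set) : Set where
    field
      card     : ℕ
      nonEmpty : NonZero card
      enum     : A ↔ Fin card

    weight : ℚ
    weight = recip card {{nonEmpty}}

  open Finite public

  abstract instance
    Fin-finite : ∀ {n} .{{_ : NonZero n}} → Finite (Fin n)
    -- The instance argument is irrelevant but the field is not; deciding `NonZero n` recovers a
    -- usable proof.
    Fin-finite {n} = record { card = n ; nonEmpty = recompute (ℕₚ.nonZero? n) it ; enum = ↔-refl }

    ×-finite : ∀ {A B} {{_ : Finite A}} {{_ : Finite B}} → Finite (A × B)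
    ×-finite {{F}} {{G}} = record
      { card     = card F ℕ.* card G
      ; nonEmpty = ℕₚ.m*n≢0 (card F) (card G) {{nonEmpty F}} {{nonEmpty G}}
      ; enum     = ↔-trans (enum F ×-↔ enum G) (↔-sym Finₚ.*↔×)
      }

  abstract
    -- Abstract, so that outside this module only the laws proved here are available and no
    -- enumeration of a product is unfolded.
    𝔼 : ∀ {A} {{_ : Finite A}} → (A → ℚ) → ℚ
    𝔼 {{F}} f = weight F * sum (λ i → f (from (enum F) i))

  module _ {A : Set} {{F : Finite A}} where abstract

    𝔼-cong : {f g : A → ℚ} → (∀ a → f a ≡ g a) → 𝔼 f ≡ 𝔼 g
    𝔼-cong f≡g = cong (weight F *_) (sum-cong-≗ (f≡g ∘ from (enum F)))

    𝔼-+ : (f g : A → ℚ) → 𝔼 (λ a → f a + g a) ≡ 𝔼 f + 𝔼 g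
    𝔼-+ f g = trans (cong (weight F *_) (∑-distrib-+ (f ∘ from (enum F)) (g ∘ from (enum F))))
      (ℚₚ.*-distribˡ-+ (weight F) (sum (f ∘ from (enum F))) (sum (g ∘ from (enum F))))

    𝔼-* : ∀ c (f : A → ℚ) → 𝔼 (λ a → c * f a) ≡ c * 𝔼 f
    𝔼-* c f = trans
      (cong (weight F *_) (sym (*-distribˡ-sum c (f ∘ from (enum F)))))
      (swap-factors (weight F) c (sum (f ∘ from (enum F))))
      where
      swap-factors : ∀ w c s → w * (c * s) ≡ c * (w * s)
      swap-factors = solve-∀ ℚ-ring

    𝔼-1 : 𝔼 (λ (_ : A) → 1ℚ) ≡ 1ℚ
    𝔼-1 = trans (*-distribˡ-sum {card F} w (λ _ → 1ℚ))
      (trans (sum-cong-≗ {card F} (λ _ → ℚₚ.*-identityʳ w))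
        (trans (sum-recip (card F) (card F) {{nonEmpty F}}) (/-self (card F) {{nonEmpty F}})))
      where
      w : ℚ
      w = weight F

    𝔼-mono : {f g : A → ℚ} → (∀ a → f a ≤ g a) → 𝔼 f ≤ 𝔼 g
    𝔼-mono f≤g = ℚₚ.*-monoˡ-≤-nonNeg (weight F) {{ℚ.nonNegative (0≤recip (card F) {{nonEmpty F}})}}
      (sum-mono (f≤g ∘ from (enum F)))

  abstract
    -- Through the two enumerations `e` becomes a permutation `π` of indices, so the weights agree
    -- as well. Applied to a rotation map, this says that a random edge traversed backwards is again
    -- uniform.
    𝔼-bij : ∀ {A B} {{F : Finite A}} {{G : Finite B}} (e : A ↔ B) (g : B → ℚ) →
      𝔼 g ≡ 𝔼 (g ∘ to e)
    𝔼-bij {{F}} {{G}} e g = cong₂ _*_ (1/-cong {{nonEmpty G}} {{nonEmpty F}} (↔⇒≡ (↔-sym π)))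
      (trans (sum-permute (g ∘ from (enum G)) π)
        (sum-cong-≗ λ i → cong g (strictlyInverseʳ (enum G) (to e (from (enum F) i)))))
      where
      π : Fin (card F) ↔ Fin (card G)
      π = ↔-trans (↔-sym (enum F)) (↔-trans e (enum G))
      1/-cong : ∀ {m n} .{{_ : NonZero m}} .{{_ : NonZero n}} → m ≡ n → recip m ≡ recip n
      1/-cong refl = refl

    𝔼-× : ∀ {A B} {{F : Finite A}} {{G : Finite B}} (f : A × B → ℚ) →
      𝔼 f ≡ 𝔼 λ a → 𝔼 λ b → f (a , b)
    𝔼-× {A} {B} {{F}} {{G}} f = begin
      wFG * sum h
        ≡⟨ cong (wFG *_) (sum-combine (card F) h) ⟩
      wFG * sum (λ i → sum λ j → h (combine {card F} i j))
        ≡⟨ cong (wFG *_) (sum-cong-≗ λ i → sum-cong-≗ λ j →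
             cong fromPair (Finₚ.remQuot-combine {card F} i j)) ⟩
      wFG * sum g
        ≡⟨ cong (_* sum g) (sym (recip-* (card F) (card G) {{nonEmpty F}} {{nonEmpty G}})) ⟩
      (wF * wG) * sum g
        ≡⟨ ℚₚ.*-assoc wF wG (sum g) ⟩
      wF * (wG * sum g)
        ≡⟨ cong (wF *_) (*-distribˡ-sum wG g) ⟩
      wF * sum (λ i → wG * g i) ∎
      where
      open ≡-Reasoning
      wF wG wFG : ℚ
      wF  = weight F
      wG  = weight G
      wFG = weight (×-finite {{F}} {{G}})
      fromPair : Fin (card F) × Fin (card G) → ℚ
      fromPair (i , j) = f (from (enum F) i , from (enum G) j)
      h : Fin (card F ℕ.* card G) → ℚ
      h k = fromPair (remQuot {card F} (card G) k)
      g : Fin (card F) → ℚ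
      g i = sum λ j → fromPair (i , j)

    𝔼-Fin : ∀ {n} .{{_ : NonZero n}} (f : Fin n → ℚ) → 𝔼 f ≡ recip n * sum f
    𝔼-Fin f = refl

-- Variance of functions on finite sets.

module Variance where

  open Averages
  open import Data.Rational using (_+_; _*_; _-_; -_; _≤_; _<_)
  open Inverse using (to)

  ≤-of-diff : ∀ {p q} d → 0ℚ ≤ d → q ≡ p + d → p ≤ q
  ≤-of-diff {p} d 0≤d q≡p+d = subst (p ≤_) (sym q≡p+d)
    (ℚₚ.≤-trans (ℚₚ.≤-reflexive (sym (ℚₚ.+-identityʳ p))) (ℚₚ.+-monoʳ-≤ p 0≤d))

  *-monoʳ : ∀ c {p q} → 0ℚ ≤ c → p ≤ q → c * p ≤ c * q
  *-monoʳ c 0≤c = ℚₚ.*-monoˡ-≤-nonNeg c {{ℚ.nonNegative 0≤c}}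

  *-monoˡ : ∀ c {p q} → 0ℚ ≤ c → p ≤ q → p * c ≤ q * c
  *-monoˡ c 0≤c = ℚₚ.*-monoʳ-≤-nonNeg c {{ℚ.nonNegative 0≤c}}

  *-cancelˡ : ∀ c {p q} → 0ℚ < c → c * p ≤ c * q → p ≤ q
  *-cancelˡ c 0<c = ℚₚ.*-cancelˡ-≤-pos c {{ℚ.positive 0<c}}

  0≤* : ∀ {p q} → 0ℚ ≤ p → 0ℚ ≤ q → 0ℚ ≤ p * q
  0≤* {p} {q} 0≤p 0≤q = subst (_≤ p * q) (ℚₚ.*-zeroʳ p) (*-monoʳ p 0≤p 0≤q)

  0<* : ∀ {p q} → 0ℚ < p → 0ℚ < q → 0ℚ < p * q
  0<* {p} {q} 0<p 0<q = subst (_< p * q) (ℚₚ.*-zeroʳ p) (ℚₚ.*-monoʳ-<-pos p {{ℚ.positive 0<p}} 0<q)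

  0≤+ : ∀ {p q} → 0ℚ ≤ p → 0ℚ ≤ q → 0ℚ ≤ p + q
  0≤+ {p} {q} 0≤p 0≤q = subst (_≤ p + q) (ℚₚ.+-identityˡ 0ℚ) (ℚₚ.+-mono-≤ 0≤p 0≤q)

  0≤square : ∀ p → 0ℚ ≤ p * p
  0≤square p with ℚₚ.≤-total 0ℚ p
  ... | inj₁ 0≤p = 0≤* 0≤p 0≤p
  ... | inj₂ p≤0 = subst (0ℚ ≤_) (neg*neg p) (0≤* 0≤-p 0≤-p)
    where
    0≤-p : 0ℚ ≤ - p
    0≤-p = ℚₚ.neg-antimono-≤ p≤0
    neg*neg : ∀ p → - p * - p ≡ p * p
    neg*neg = solve-∀ ℚ-ring

  square-mono : ∀ {p q} → 0ℚ ≤ p → p ≤ q → p * p ≤ q * q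
  square-mono {p} {q} 0≤p p≤q =
    ℚₚ.≤-trans (*-monoʳ p 0≤p p≤q) (*-monoˡ q (ℚₚ.≤-trans 0≤p p≤q) p≤q)

  Var : ∀ {A} {{_ : Finite A}} → (A → ℚ) → ℚ
  Var f = 𝔼 (λ a → f a * f a) - 𝔼 f * 𝔼 f

  Cov : ∀ {A} {{_ : Finite A}} → (A → ℚ) → (A → ℚ) → ℚ
  Cov f g = 𝔼 (λ a → f a * g a) - 𝔼 f * 𝔼 g

  module _ {A : Set} {{_ : Finite A}} where

    𝔼-const : ∀ c → 𝔼 (λ (_ : A) → c) ≡ c
    𝔼-const c = begin
      𝔼 (λ (_ : A) → c)       ≡⟨ 𝔼-cong (λ _ → sym (ℚₚ.*-identityʳ c)) ⟩
      𝔼 (λ (_ : A) → c * 1ℚ)  ≡⟨ 𝔼-* c (λ (_ : A) → 1ℚ) ⟩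
      c * 𝔼 (λ (_ : A) → 1ℚ)  ≡⟨ cong (c *_) 𝔼-1 ⟩
      c * 1ℚ                  ≡⟨ ℚₚ.*-identityʳ c ⟩
      c                       ∎
      where open ≡-Reasoning

    𝔼-linear : ∀ c d (f g : A → ℚ) → 𝔼 (λ a → c * f a + d * g a) ≡ c * 𝔼 f + d * 𝔼 g
    𝔼-linear c d f g = trans (𝔼-+ (λ a → c * f a) (λ a → d * g a)) (cong₂ _+_ (𝔼-* c f) (𝔼-* d g))

    𝔼-sub : (f : A → ℚ) (c : ℚ) → 𝔼 (λ a → f a - c) ≡ 𝔼 f - c
    𝔼-sub f c = trans (𝔼-+ f (λ _ → - c)) (cong (λ z → 𝔼 f + z) (𝔼-const (- c)))

    𝔼-square-linear : ∀ c d (f g : A → ℚ) →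
      𝔼 (λ a → (c * f a + d * g a) * (c * f a + d * g a)) ≡
      c * c * 𝔼 (λ a → f a * f a) +
        ((c * d + c * d) * 𝔼 (λ a → f a * g a) + d * d * 𝔼 (λ a → g a * g a))
    𝔼-square-linear c d f g = begin
      𝔼 (λ a → (c * f a + d * g a) * (c * f a + d * g a))
        ≡⟨ 𝔼-cong (λ a → expand c d (f a) (g a)) ⟩
      𝔼 (λ a → c * c * (f a * f a) + 1ℚ * ((c * d + c * d) * (f a * g a) + d * d * (g a * g a)))
        ≡⟨ 𝔼-linear (c * c) 1ℚ (λ a → f a * f a)
             (λ a → (c * d + c * d) * (f a * g a) + d * d * (g a * g a)) ⟩
      c * c * 𝔼 (λ a → f a * f a) +
        1ℚ * 𝔼 (λ a → (c * d + c * d) * (f a * g a) + d * d * (g a * g a))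
        ≡⟨ cong (λ z → c * c * 𝔼 (λ a → f a * f a) + z) (trans (ℚₚ.*-identityˡ _)
             (𝔼-linear (c * d + c * d) (d * d) (λ a → f a * g a) (λ a → g a * g a))) ⟩
      c * c * 𝔼 (λ a → f a * f a) +
        ((c * d + c * d) * 𝔼 (λ a → f a * g a) + d * d * 𝔼 (λ a → g a * g a)) ∎
      where
      open ≡-Reasoning
      expand : ∀ c d x y → (c * x + d * y) * (c * x + d * y) ≡
        c * c * (x * x) + 1ℚ * ((c * d + c * d) * (x * y) + d * d * (y * y))
      expand = solve-∀ ℚ-ring

    Var-cong : {f g : A → ℚ} → (∀ a → f a ≡ g a) → Var f ≡ Var g
    Var-cong f≡g = cong₂ _-_ (𝔼-cong λ a → cong₂ _*_ (f≡g a) (f≡g a))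
      (cong₂ _*_ (𝔼-cong f≡g) (𝔼-cong f≡g))

    Var-const : ∀ c → Var (λ (_ : A) → c) ≡ 0ℚ
    Var-const c = trans (cong₂ (λ x y → x - y * y) (𝔼-const (c * c)) (𝔼-const c))
      (ℚₚ.+-inverseʳ (c * c))

    Var-linear : ∀ c d (f g : A → ℚ) → Var (λ a → c * f a + d * g a) ≡
      c * c * Var f + ((c * d + c * d) * Cov f g + d * d * Var g)
    Var-linear c d f g =
      trans (cong₂ (λ x y → x - y * y) (𝔼-square-linear c d f g) (𝔼-linear c d f g))
        (collect c d (𝔼 (λ a → f a * f a)) (𝔼 (λ a → f a * g a)) (𝔼 (λ a → g a * g a)) (𝔼 f) (𝔼 g))
      where
      collect : ∀ c d x y z p q →
        c * c * x + ((c * d + c * d) * y + d * d * z) - (c * p + d * q) * (c * p + d * q) ≡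
        c * c * (x - p * p) + ((c * d + c * d) * (y - p * q) + d * d * (z - q * q))
      collect = solve-∀ ℚ-ring

    Var-sub : (f : A → ℚ) (c : ℚ) → Var (λ a → f a - c) ≡ Var f
    Var-sub f c = begin
      Var (λ a → f a - c)                 ≡⟨ Var-cong (λ a → as-linear (f a) c) ⟩
      Var (λ a → 1ℚ * f a + (- c) * 1ℚ)   ≡⟨ Var-linear 1ℚ (- c) f (λ _ → 1ℚ) ⟩
      1ℚ * 1ℚ * Var f + ((1ℚ * - c + 1ℚ * - c) * Cov f (λ _ → 1ℚ) + (- c) * (- c) * Var (λ (_ : A) → 1ℚ))
        ≡⟨ cong₂ (λ x y → 1ℚ * 1ℚ * Var f + ((1ℚ * - c + 1ℚ * - c) * x + (- c) * (- c) * y))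
             cov≡0 (Var-const 1ℚ) ⟩
      1ℚ * 1ℚ * Var f + ((1ℚ * - c + 1ℚ * - c) * 0ℚ + (- c) * (- c) * 0ℚ)
        ≡⟨ drop (Var f) c ⟩
      Var f ∎
      where
      open ≡-Reasoning
      as-linear : ∀ x c → x - c ≡ 1ℚ * x + (- c) * 1ℚ
      as-linear = solve-∀ ℚ-ring
      drop : ∀ x c → 1ℚ * 1ℚ * x + ((1ℚ * - c + 1ℚ * - c) * 0ℚ + (- c) * (- c) * 0ℚ) ≡ x
      drop = solve-∀ ℚ-ring
      cancel : ∀ x → x - x * 1ℚ ≡ 0ℚ
      cancel = solve-∀ ℚ-ring
      cov≡0 : Cov f (λ _ → 1ℚ) ≡ 0ℚ
      cov≡0 = trans (cong₂ (λ x y → x - 𝔼 f * y) (𝔼-cong (λ a → ℚₚ.*-identityʳ (f a))) 𝔼-1)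
        (cancel (𝔼 f))

    Var-centred : (f : A → ℚ) → Var f ≡ 𝔼 (λ a → (f a - 𝔼 f) * (f a - 𝔼 f))
    Var-centred f = trans (sym (Var-sub f (𝔼 f)))
      (trans (cong (λ z → 𝔼 (λ a → (f a - 𝔼 f) * (f a - 𝔼 f)) - z * z)
          (trans (𝔼-sub f (𝔼 f)) (ℚₚ.+-inverseʳ (𝔼 f))))
        (drop _))
      where
      drop : ∀ x → x - 0ℚ * 0ℚ ≡ x
      drop = solve-∀ ℚ-ring

    0≤𝔼 : {f : A → ℚ} → (∀ a → 0ℚ ≤ f a) → 0ℚ ≤ 𝔼 f
    0≤𝔼 {f} 0≤f = subst (_≤ 𝔼 f) (𝔼-const 0ℚ) (𝔼-mono 0≤f)

    0≤Var : (f : A → ℚ) → 0ℚ ≤ Var f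
    0≤Var f = subst (0ℚ ≤_) (sym (Var-centred f)) (0≤𝔼 λ a → 0≤square (f a - 𝔼 f))

    square-𝔼≤ : (f : A → ℚ) → 𝔼 f * 𝔼 f ≤ 𝔼 (λ a → f a * f a)
    square-𝔼≤ f = ≤-of-diff (Var f) (0≤Var f) (add-back (𝔼 (λ a → f a * f a)) (𝔼 f * 𝔼 f))
      where
      add-back : ∀ x y → x ≡ y + (x - y)
      add-back = solve-∀ ℚ-ring

    -- The difference of the two sides is the variance of l f − m g.
    Var-+≤ : ∀ m l (f g : A → ℚ) →
      m * l * Var (λ a → f a + g a) ≤ (m + l) * (l * Var f + m * Var g)
    Var-+≤ m l f g = ≤-of-diff (Var (λ a → l * f a + - m * g a)) (0≤Var (λ a → l * f a + - m * g a))
      (begin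
        (m + l) * (l * Var f + m * Var g)
          ≡⟨ rearrange m l (Var f) (Cov f g) (Var g) ⟩
        m * l * (1ℚ * 1ℚ * Var f + ((1ℚ * 1ℚ + 1ℚ * 1ℚ) * Cov f g + 1ℚ * 1ℚ * Var g)) +
          (l * l * Var f + ((l * - m + l * - m) * Cov f g + - m * - m * Var g))
          ≡⟨ cong₂ (λ x y → m * l * x + y) (sym (Var-linear 1ℚ 1ℚ f g)) (sym (Var-linear l (- m) f g)) ⟩
        m * l * Var (λ a → 1ℚ * f a + 1ℚ * g a) + Var (λ a → l * f a + - m * g a)
          ≡⟨ cong (λ x → m * l * x + Var (λ a → l * f a + - m * g a))
               (Var-cong λ a → cong₂ _+_ (ℚₚ.*-identityˡ (f a)) (ℚₚ.*-identityˡ (g a))) ⟩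
        m * l * Var (λ a → f a + g a) + Var (λ a → l * f a + - m * g a) ∎)
      where
      open ≡-Reasoning
      rearrange : ∀ m l x y z → (m + l) * (l * x + m * z) ≡
        m * l * (1ℚ * 1ℚ * x + ((1ℚ * 1ℚ + 1ℚ * 1ℚ) * y + 1ℚ * 1ℚ * z)) +
          (l * l * x + ((l * - m + l * - m) * y + - m * - m * z))
      rearrange = solve-∀ ℚ-ring

  Var-bij : ∀ {A B} {{_ : Finite A}} {{_ : Finite B}} (e : A ↔ B) (g : B → ℚ) →
    Var g ≡ Var (g ∘ to e)
  Var-bij e g = cong₂ (λ x y → x - y * y) (𝔼-bij e (λ b → g b * g b)) (𝔼-bij e g)

  module _ {A B : Set} {{_ : Finite A}} {{_ : Finite B}} where

    ×-swap : (A × B) ↔ (B × A)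
    ×-swap = mk↔ₛ′ swap swap (λ _ → refl) (λ _ → refl)

    𝔼-comm : (f : A → B → ℚ) → 𝔼 (λ a → 𝔼 (λ b → f a b)) ≡ 𝔼 (λ b → 𝔼 (λ a → f a b))
    𝔼-comm f = begin
      𝔼 (λ a → 𝔼 (λ b → f a b))   ≡⟨ 𝔼-× (λ ((a , b) : A × B) → f a b) ⟨
      𝔼 (λ ((a , b) : A × B) → f a b)  ≡⟨ 𝔼-bij (↔-sym ×-swap) (λ ((a , b) : A × B) → f a b) ⟩
      𝔼 (λ ((b , a) : B × A) → f a b)  ≡⟨ 𝔼-× (λ ((b , a) : B × A) → f a b) ⟩
      𝔼 (λ b → 𝔼 (λ a → f a b))   ∎
      where open ≡-Reasoning

    -- Pythagoras for the functions constant on the fibres over `A` and those of mean zero on every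
    -- fibre: adding and subtracting `𝔼 (e²)` separates the two squared lengths. Both product
    -- constructions are analysed through it.
    total-variance : (f : A × B → ℚ) →
      Var f ≡ 𝔼 (λ a → Var (λ b → f (a , b))) + Var (λ a → 𝔼 (λ b → f (a , b)))
    total-variance f = begin
      𝔼 (λ x → f x * f x) - 𝔼 f * 𝔼 f
        ≡⟨ cong₂ (λ x y → x - y * y) (𝔼-× (λ x → f x * f x)) (𝔼-× f) ⟩
      𝔼 s - 𝔼 e * 𝔼 e
        ≡⟨ insert (𝔼 s) (𝔼 (λ a → e a * e a)) (𝔼 e) ⟩
      (1ℚ * 𝔼 s + - 1ℚ * 𝔼 (λ a → e a * e a)) + Var e
        ≡⟨ cong (_+ Var e) (sym (𝔼-linear 1ℚ (- 1ℚ) s (λ a → e a * e a))) ⟩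
      𝔼 (λ a → 1ℚ * s a + - 1ℚ * (e a * e a)) + Var e
        ≡⟨ cong (_+ Var e) (𝔼-cong λ a → minus (s a) (e a * e a)) ⟩
      𝔼 (λ a → Var (λ b → f (a , b))) + Var e ∎
      where
      open ≡-Reasoning
      s e : A → ℚ
      s a = 𝔼 (λ b → f (a , b) * f (a , b))
      e a = 𝔼 (λ b → f (a , b))
      insert : ∀ x y z → x - z * z ≡ (1ℚ * x + - 1ℚ * y) + (y - z * z)
      insert = solve-∀ ℚ-ring
      minus : ∀ x y → 1ℚ * x + - 1ℚ * y ≡ x - y
      minus = solve-∀ ℚ-ring

    -- Centre each `f a` at its own mean and apply `square-𝔼≤` at every `b`. It will be applied with
    -- `A` the edge labels at a vertex: averaging over neighbours cannot raise the variance.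
    Var-convex : (f : A → B → ℚ) → Var (λ b → 𝔼 (λ a → f a b)) ≤ 𝔼 (λ a → Var (f a))
    Var-convex f = begin
      Var (λ b → 𝔼 (λ a → f a b))
        ≡⟨ Var-centred (λ b → 𝔼 (λ a → f a b)) ⟩
      𝔼 (λ b → (𝔼 (λ a → f a b) - c) * (𝔼 (λ a → f a b) - c))
        ≡⟨ 𝔼-cong (λ b → cong₂ _*_ (centre b) (centre b)) ⟩
      𝔼 (λ b → 𝔼 (λ a → f a b - 𝔼 (f a)) * 𝔼 (λ a → f a b - 𝔼 (f a)))
        ≤⟨ 𝔼-mono (λ b → square-𝔼≤ (λ a → f a b - 𝔼 (f a))) ⟩
      𝔼 (λ b → 𝔼 (λ a → (f a b - 𝔼 (f a)) * (f a b - 𝔼 (f a))))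
        ≡⟨ 𝔼-comm (λ a b → (f a b - 𝔼 (f a)) * (f a b - 𝔼 (f a))) ⟨
      𝔼 (λ a → 𝔼 (λ b → (f a b - 𝔼 (f a)) * (f a b - 𝔼 (f a))))
        ≡⟨ 𝔼-cong (λ a → Var-centred (f a)) ⟨
      𝔼 (λ a → Var (f a)) ∎
      where
      open ℚₚ.≤-Reasoning
      c : ℚ
      c = 𝔼 (λ b → 𝔼 (λ a → f a b))
      minus : ∀ x y → 1ℚ * x + - 1ℚ * y ≡ x - y
      minus = solve-∀ ℚ-ring
      centre : ∀ b → 𝔼 (λ a → f a b) - c ≡ 𝔼 (λ a → f a b - 𝔼 (f a))
      centre b = trans (cong (λ z → 𝔼 (λ a → f a b) - z) (sym (𝔼-comm f)))
        (trans (sym (minus (𝔼 (λ a → f a b)) (𝔼 (λ a → 𝔼 (f a)))))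
          (trans (sym (𝔼-linear 1ℚ (- 1ℚ) (λ a → f a b) (λ a → 𝔼 (f a))))
            (𝔼-cong λ a → minus (f a b) (𝔼 (f a)))))

-- Contraction of variance under squares, renamings, tensor and zig-zag products.

module Expanders where

  open Averages
  open Variance
  open import Data.Rational using (_+_; _*_; _-_; -_; _≤_; _<_)
  open Inverse using (to; from; strictlyInverseʳ)

  walk : ∀ {V L} {{_ : Finite L}} → Graph V L → (V → ℚ) → V → ℚ
  walk G α v = 𝔼 λ i → α (proj₁ (rot G (v , i)))

  -- λ(G) ≤ q in terms of variances: Var α is the normalised square norm of
  -- the component of α orthogonal to the constants.
  record Expansion {V L} {{_ : Finite V}} {{_ : Finite L}} (G : Graph V L) (q : ℚ) : Set where
    field contraction : ∀ α → Var (walk G α) ≤ q * q * Var α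

  open Expansion public

  rot-↔ : ∀ {V L} → Graph V L → (V × L) ↔ (V × L)
  rot-↔ G = mk↔ₛ′ (rot G) (rot G) (involutive G) (involutive G)

  module _ {V L : Set} {{_ : Finite V}} {{_ : Finite L}} (G : Graph V L) where

    -- `rot G` permutes `V × L`, so the endpoint of a uniformly random edge is a uniformly random
    -- vertex. This is where regularity enters.
    𝔼-walk : ∀ α → 𝔼 (walk G α) ≡ 𝔼 α
    𝔼-walk α = begin
      𝔼 (walk G α)                        ≡⟨ 𝔼-× (α ∘ proj₁ ∘ rot G) ⟨
      𝔼 (α ∘ proj₁ ∘ rot G)               ≡⟨ 𝔼-bij (rot-↔ G) (α ∘ proj₁) ⟨
      𝔼 (α ∘ proj₁)                       ≡⟨ 𝔼-× (λ ((v , _) : V × L) → α v) ⟩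
      𝔼 (λ v → 𝔼 (λ (_ : L) → α v))       ≡⟨ 𝔼-cong (λ v → 𝔼-const (α v)) ⟩
      𝔼 α                                 ∎
      where open ≡-Reasoning

    expansion-mono : ∀ {p q} → 0ℚ ≤ p → p ≤ q → Expansion G p → Expansion G q
    contraction (expansion-mono 0≤p p≤q G-p) α =
      ℚₚ.≤-trans (contraction G-p α) (*-monoˡ (Var α) (0≤Var α) (square-mono 0≤p p≤q))

    -- Expansion sees the neighbours only.  Equality of graphs would also
    -- involve the proofs of involutivity.
    expansion-cong : ∀ {G′ : Graph V L} {q} →
      (∀ e → proj₁ (rot G e) ≡ proj₁ (rot G′ e)) → Expansion G q → Expansion G′ q
    contraction (expansion-cong {q = q} same G-q) α = subst (_≤ q * q * Var α)
      (Var-cong λ v → 𝔼-cong λ i → cong α (same (v , i))) (contraction G-q α)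

    -- The inequality `square-𝔼≤` at each vertex bounds the square of the walk by the walk of the
    -- square, and `𝔼-walk` gives that the same mean as `α²`.
    expansion-1 : Expansion G 1ℚ
    contraction expansion-1 α = begin
      𝔼 (λ v → walk G α v * walk G α v) - 𝔼 (walk G α) * 𝔼 (walk G α)
        ≡⟨ cong (λ z → 𝔼 (λ v → walk G α v * walk G α v) - z * z) (𝔼-walk α) ⟩
      𝔼 (λ v → walk G α v * walk G α v) - 𝔼 α * 𝔼 α
        ≤⟨ ℚₚ.+-monoˡ-≤ (- (𝔼 α * 𝔼 α)) (𝔼-mono λ v → square-𝔼≤ (λ i → α (proj₁ (rot G (v , i))))) ⟩
      𝔼 (walk G (λ v → α v * α v)) - 𝔼 α * 𝔼 α
        ≡⟨ cong (_- 𝔼 α * 𝔼 α) (𝔼-walk (λ v → α v * α v)) ⟩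
      Var α
        ≡⟨ ones (Var α) ⟩
      1ℚ * 1ℚ * Var α ∎
      where
      open ℚₚ.≤-Reasoning
      ones : ∀ x → x ≡ 1ℚ * 1ℚ * x
      ones = solve-∀ ℚ-ring

    expansion-square : ∀ {q} → Expansion G q → Expansion (square G) (q * q)
    contraction (expansion-square {q} G-q) α = begin
      Var (walk (square G) α)
        ≡⟨ Var-cong (λ v → 𝔼-× (λ e → α (proj₁ (rot (square G) (v , e))))) ⟩
      Var (walk G (walk G α))
        ≤⟨ contraction G-q (walk G α) ⟩
      q * q * Var (walk G α)
        ≤⟨ *-monoʳ (q * q) (0≤square q) (contraction G-q α) ⟩
      q * q * (q * q * Var α)
        ≡⟨ ℚₚ.*-assoc (q * q) (q * q) (Var α) ⟨
      q * q * (q * q) * Var α ∎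
      where open ℚₚ.≤-Reasoning

    expansion-reindex : ∀ {V′ L′} {{_ : Finite V′}} {{_ : Finite L′}} (f : V ↔ V′) (g : L ↔ L′) {q} →
      Expansion G q → Expansion (reindex f g G) q
    contraction (expansion-reindex f g {q} G-q) α = begin
      Var (walk (reindex f g G) α)
        ≡⟨ Var-cong (λ v → trans (𝔼-bij g (λ i → α (proj₁ (rot (reindex f g G) (v , i)))))
             (𝔼-cong λ i → cong (λ j → α (to f (proj₁ (rot G (from f v , j))))) (strictlyInverseʳ g i))) ⟩
      Var (walk G (α ∘ to f) ∘ from f)
        ≡⟨ Var-bij (↔-sym f) (walk G (α ∘ to f)) ⟨
      Var (walk G (α ∘ to f))
        ≤⟨ contraction G-q (α ∘ to f) ⟩
      q * q * Var (α ∘ to f)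
        ≡⟨ cong (q * q *_) (Var-bij f α) ⟨
      q * q * Var α ∎
      where open ℚₚ.≤-Reasoning

  module _ {V₁ V₂ L₁ L₂ : Set}
    {{_ : Finite V₁}} {{_ : Finite V₂}} {{_ : Finite L₁}} {{_ : Finite L₂}}
    {G₁ : Graph V₁ L₁} {G₂ : Graph V₂ L₂} where

    -- The variance over a product splits into the mean of the variances along
    -- the second factor and the variance of the means; the former is
    -- contracted by G₂ and the latter by G₁.
    expansion-⊗ : ∀ {q} → Expansion G₁ q → Expansion G₂ q → Expansion (G₁ ⊗ G₂) q
    contraction (expansion-⊗ {q} G₁-q G₂-q) α = begin
      Var (walk (G₁ ⊗ G₂) α)
        ≡⟨ Var-cong (λ (v , w) → 𝔼-× (λ e → α (proj₁ (rot (G₁ ⊗ G₂) ((v , w) , e))))) ⟩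
      Var h
        ≡⟨ total-variance h ⟩
      𝔼 (λ v → Var (λ w → h (v , w))) + Var (λ v → 𝔼 (λ w → h (v , w)))
        ≤⟨ ℚₚ.+-mono-≤ within between ⟩
      q * q * 𝔼 (λ v → Var (λ w → α (v , w))) + q * q * Var (λ v → 𝔼 (λ w → α (v , w)))
        ≡⟨ ℚₚ.*-distribˡ-+ (q * q) _ _ ⟨
      q * q * (𝔼 (λ v → Var (λ w → α (v , w))) + Var (λ v → 𝔼 (λ w → α (v , w))))
        ≡⟨ cong (q * q *_) (total-variance α) ⟨
      q * q * Var α ∎
      where
      open ℚₚ.≤-Reasoning
      g : V₁ → V₂ → ℚ
      g v = walk G₂ (λ w → α (v , w))
      h : V₁ × V₂ → ℚ
      h (v , w) = walk G₁ (λ v → g v w) v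
      -- Averaging over `G₁`-neighbours does not raise the variance along `w`, by convexity; what
      -- remains is a mean over `v` that the walk preserves, and only then does `G₂` contract. In
      -- `between` it is `G₂` that preserves the means.
      within : 𝔼 (λ v → Var (λ w → h (v , w))) ≤ q * q * 𝔼 (λ v → Var (λ w → α (v , w)))
      within = begin
        𝔼 (λ v → Var (λ w → h (v , w)))
          ≤⟨ 𝔼-mono (λ v → Var-convex (λ i w → g (proj₁ (rot G₁ (v , i))) w)) ⟩
        𝔼 (walk G₁ (λ v → Var (g v)))
          ≡⟨ 𝔼-walk G₁ (λ v → Var (g v)) ⟩
        𝔼 (λ v → Var (g v))
          ≤⟨ 𝔼-mono (λ v → contraction G₂-q (λ w → α (v , w))) ⟩
        𝔼 (λ v → q * q * Var (λ w → α (v , w)))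
          ≡⟨ 𝔼-* (q * q) (λ v → Var (λ w → α (v , w))) ⟩
        q * q * 𝔼 (λ v → Var (λ w → α (v , w))) ∎
      between : Var (λ v → 𝔼 (λ w → h (v , w))) ≤ q * q * Var (λ v → 𝔼 (λ w → α (v , w)))
      between = begin
        Var (λ v → 𝔼 (λ w → h (v , w)))
          ≡⟨ Var-cong (λ v → 𝔼-comm (λ w i → g (proj₁ (rot G₁ (v , i))) w)) ⟩
        Var (walk G₁ (λ v → 𝔼 (g v)))
          ≡⟨ Var-cong (λ v → 𝔼-cong λ i → 𝔼-walk G₂ (λ w → α (proj₁ (rot G₁ (v , i)) , w))) ⟩
        Var (walk G₁ (λ v → 𝔼 (λ w → α (v , w))))
          ≤⟨ contraction G₁-q (λ v → 𝔼 (λ w → α (v , w))) ⟩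
        q * q * Var (λ v → 𝔼 (λ w → α (v , w))) ∎

  module _ {V K L : Set} {{_ : Finite V}} {{_ : Finite K}} {{_ : Finite L}}
    {G₁ : Graph V K} {G₂ : Graph K L} where

    -- On the square roots of `P` and `R`, the deviations of the cloud means and of the remainder, a
    -- step is dominated by the symmetric matrix with rows (m, l) and (l, m), whose norm is m + l.
    -- The computation is this statement squared and multiplied by `m * l`, which removes all roots
    -- and quotients.
    expansion-zigzag : ∀ {m l} → 0ℚ < l → l * l ≤ m → Expansion G₁ m → Expansion G₂ l →
      Expansion (zigzag G₁ G₂) (m + l)
    contraction (expansion-zigzag {m} {l} 0<l l²≤m G₁-m G₂-l) α = *-cancelˡ (m * l) (0<* 0<m 0<l) (begin
      m * l * Var (walk (zigzag G₁ G₂) α)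
        ≡⟨ cong (m * l *_) (trans
             (Var-cong λ (v , k) → 𝔼-× (λ e → α (proj₁ (rot (zigzag G₁ G₂) ((v , k) , e)))))
             (total-variance (λ (v , k) → walk G₂ (g v) k))) ⟩
      m * l * (𝔼 (λ v → Var (walk G₂ (g v))) + Var (λ v → 𝔼 (walk G₂ (g v))))
        ≤⟨ *-monoʳ (m * l) 0≤ml (ℚₚ.+-mono-≤
             (ℚₚ.≤-trans (𝔼-mono λ v → contraction G₂-l (g v)) (ℚₚ.≤-reflexive (𝔼-* (l * l) (λ v → Var (g v)))))
             (ℚₚ.≤-reflexive (Var-cong λ v →
               trans (𝔼-walk G₂ (g v)) (trans (𝔼-cong (g≡x+y v)) (𝔼-+ (x v) (y v)))))) ⟩
      m * l * (l * l * 𝔼 (λ v → Var (g v)) + Var (λ v → 𝔼 (x v) + 𝔼 (y v)))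
        ≡⟨ distribute m l (𝔼 (λ v → Var (g v))) (Var (λ v → 𝔼 (x v) + 𝔼 (y v))) ⟩
      l * l * (m * l * 𝔼 (λ v → Var (g v))) + m * l * Var (λ v → 𝔼 (x v) + 𝔼 (y v))
        -- The weights are opposite in the two estimates: `m` on `X′` and `l` on `Y′` within the
        -- clouds, `l` on `X` and `m` on `Y` for the means. With the four bounds below and
        -- `l⁴ ≤ m²`, every term then contains the factor `m * l`.
        ≤⟨ ℚₚ.+-mono-≤ (*-monoʳ (l * l) (0≤square l) within)
             (Var-+≤ m l (λ v → 𝔼 (x v)) (λ v → 𝔼 (y v))) ⟩
      l * l * ((m + l) * (m * X′ + l * Y′)) + (m + l) * (l * X + m * Y)
        ≡⟨ regroup m l X X′ Y Y′ ⟩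
      (m + l) * (l * (l * (m * X′)) + l * (l * (l * Y′)) + l * X + m * Y)
        ≤⟨ *-monoʳ (m + l) 0≤m+l (ℚₚ.+-mono-≤ (ℚₚ.+-mono-≤ (ℚₚ.+-mono-≤
             (*-monoʳ l 0≤l (*-monoʳ l 0≤l (*-monoʳ m 0≤m X′≤P)))
             (*-monoʳ l 0≤l (*-monoʳ l 0≤l (*-monoʳ l 0≤l Y′≤l²R))))
             (*-monoʳ l 0≤l X≤m²P))
             (*-monoʳ m 0≤m Y≤l²R)) ⟩
      (m + l) * (l * (l * (m * P)) + l * (l * (l * (l * l * R))) + l * (m * m * P) + m * (l * l * R))
        ≡⟨ collect m l P R ⟩
      (m + l) * (m * l * (m + l) * P + m * l * l * R + l * R * (l * l * (l * l)))
        ≤⟨ *-monoʳ (m + l) 0≤m+l (ℚₚ.+-monoʳ-≤ (m * l * (m + l) * P + m * l * l * R)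
             (*-monoʳ (l * R) (0≤* 0≤l 0≤R) (square-mono (0≤square l) l²≤m))) ⟩
      (m + l) * (m * l * (m + l) * P + m * l * l * R + l * R * (m * m))
        ≡⟨ factor m l P R ⟩
      m * l * ((m + l) * (m + l) * (R + P))
        ≡⟨ cong (λ z → m * l * ((m + l) * (m + l) * z)) (total-variance α) ⟨
      m * l * ((m + l) * (m + l) * Var α) ∎)
      where
      open ℚₚ.≤-Reasoning
      0<m : 0ℚ < m
      0<m = ℚₚ.<-≤-trans (0<* 0<l 0<l) l²≤m
      0≤m : 0ℚ ≤ m
      0≤m = ℚₚ.<⇒≤ 0<m
      0≤l : 0ℚ ≤ l
      0≤l = ℚₚ.<⇒≤ 0<l
      0≤ml : 0ℚ ≤ m * l
      0≤ml = 0≤* 0≤m 0≤l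
      0≤m+l : 0ℚ ≤ m + l
      0≤m+l = 0≤+ 0≤m 0≤l

      -- α = p + (α − p), with p constant on the clouds {v} × K and α − p of
      -- mean zero on them; x and y are the images of the two parts under the
      -- first step in G₂ and the step in G₁.
      p : V → ℚ
      p v = 𝔼 (λ k → α (v , k))
      a b : V × K → ℚ
      a (v , k) = walk G₂ (λ k → α (v , k)) k
      b (v , k) = a (v , k) - p v
      x y g : V → K → ℚ
      x v k = p (proj₁ (rot G₁ (v , k)))
      y v k = b (rot G₁ (v , k))
      g v k = a (rot G₁ (v , k))

      g≡x+y : ∀ v k → g v k ≡ x v k + y v k
      g≡x+y v k = split (a (rot G₁ (v , k))) (x v k)
        where
        split : ∀ s t → s ≡ t + (s - t)
        split = solve-∀ ℚ-ring

      P R X X′ Y Y′ : ℚ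
      P  = Var p
      R  = 𝔼 (λ v → Var (λ k → α (v , k)))
      X  = Var (λ v → 𝔼 (x v))
      X′ = 𝔼 (λ v → Var (x v))
      Y  = Var (λ v → 𝔼 (y v))
      Y′ = 𝔼 (λ v → Var (y v))

      0≤R : 0ℚ ≤ R
      0≤R = 0≤𝔼 λ v → 0≤Var (λ k → α (v , k))

      -- `rot G₁` permutes `V × K`, so the step in `G₁` keeps the total variance of `p` and merely
      -- redistributes it within and between the clouds.
      X′+X≡P : X′ + X ≡ P
      X′+X≡P = ≡.begin
        X′ + X
          ≡.≡⟨ total-variance (λ (v , k) → x v k) ⟨
        Var (p ∘ proj₁ ∘ rot G₁)
          ≡.≡⟨ Var-bij (rot-↔ G₁) (p ∘ proj₁) ⟨
        Var (λ ((v , _) : V × K) → p v)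
          ≡.≡⟨ total-variance (λ ((v , _) : V × K) → p v) ⟩
        𝔼 (λ v → Var (λ (_ : K) → p v)) + Var (λ v → 𝔼 (λ (_ : K) → p v))
          ≡.≡⟨ cong₂ _+_ (trans (𝔼-cong λ v → Var-const (p v)) (𝔼-const 0ℚ))
                 (Var-cong λ v → 𝔼-const (p v)) ⟩
        0ℚ + P
          ≡.≡⟨ ℚₚ.+-identityˡ P ⟩
        P ≡.∎
        where module ≡ = ≡-Reasoning

      -- The same conservation for `b`. Its variance lies entirely within the clouds, since `G₂`
      -- preserves the mean on each, and there the first step in `G₂` has already contracted it.
      Y′+Y≤l²R : Y′ + Y ≤ l * l * R
      Y′+Y≤l²R = begin
        Y′ + Y
          ≡⟨ total-variance (λ (v , k) → y v k) ⟨
        Var (b ∘ rot G₁)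
          ≡⟨ Var-bij (rot-↔ G₁) b ⟨
        Var b
          ≡⟨ total-variance b ⟩
        𝔼 (λ v → Var (λ k → b (v , k))) + Var (λ v → 𝔼 (λ k → b (v , k)))
          ≡⟨ cong₂ _+_ (𝔼-cong λ v → Var-sub (walk G₂ (λ k → α (v , k))) (p v))
               (trans (Var-cong mean-b) (Var-const 0ℚ)) ⟩
        𝔼 (λ v → Var (walk G₂ (λ k → α (v , k)))) + 0ℚ
          ≡⟨ ℚₚ.+-identityʳ _ ⟩
        𝔼 (λ v → Var (walk G₂ (λ k → α (v , k))))
          ≤⟨ 𝔼-mono (λ v → contraction G₂-l (λ k → α (v , k))) ⟩
        𝔼 (λ v → l * l * Var (λ k → α (v , k)))
          ≡⟨ 𝔼-* (l * l) (λ v → Var (λ k → α (v , k))) ⟩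
        l * l * R ∎
        where
        mean-b : ∀ v → 𝔼 (λ k → b (v , k)) ≡ 0ℚ
        mean-b v = trans (𝔼-sub (walk G₂ (λ k → α (v , k))) (p v))
          (trans (cong (_- p v) (𝔼-walk G₂ (λ k → α (v , k)))) (ℚₚ.+-inverseʳ (p v)))

      summandˡ : ∀ {q r s} → 0ℚ ≤ r → q + r ≤ s → q ≤ s
      summandˡ 0≤r = ℚₚ.≤-trans (≤-of-diff _ 0≤r refl)
      summandʳ : ∀ {q r s} → 0ℚ ≤ q → q + r ≤ s → r ≤ s
      summandʳ {q} {r} 0≤q = ℚₚ.≤-trans (≤-of-diff _ 0≤q (ℚₚ.+-comm q r))

      X≤m²P : X ≤ m * m * P
      X≤m²P = contraction G₁-m p
      X′≤P : X′ ≤ P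
      X′≤P = summandˡ (0≤Var (λ v → 𝔼 (x v))) (ℚₚ.≤-reflexive X′+X≡P)
      Y≤l²R : Y ≤ l * l * R
      Y≤l²R = summandʳ (0≤𝔼 λ v → 0≤Var (y v)) Y′+Y≤l²R
      Y′≤l²R : Y′ ≤ l * l * R
      Y′≤l²R = summandˡ (0≤Var (λ v → 𝔼 (y v))) Y′+Y≤l²R

      within : m * l * 𝔼 (λ v → Var (g v)) ≤ (m + l) * (m * X′ + l * Y′)
      within = begin
        m * l * 𝔼 (λ v → Var (g v))
          ≡⟨ 𝔼-* (m * l) (λ v → Var (g v)) ⟨
        𝔼 (λ v → m * l * Var (g v))
          ≤⟨ 𝔼-mono (λ v → ℚₚ.≤-trans (ℚₚ.≤-reflexive (cong₂ _*_ (ℚₚ.*-comm m l) (Var-cong (g≡x+y v))))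
               (Var-+≤ l m (x v) (y v))) ⟩
        𝔼 (λ v → (l + m) * (m * Var (x v) + l * Var (y v)))
          ≡⟨ 𝔼-* (l + m) (λ v → m * Var (x v) + l * Var (y v)) ⟩
        (l + m) * 𝔼 (λ v → m * Var (x v) + l * Var (y v))
          ≡⟨ cong₂ _*_ (ℚₚ.+-comm l m) (𝔼-linear m l (λ v → Var (x v)) (λ v → Var (y v))) ⟩
        (m + l) * (m * X′ + l * Y′) ∎

      distribute : ∀ m l s t → m * l * (l * l * s + t) ≡ l * l * (m * l * s) + m * l * t
      distribute = solve-∀ ℚ-ring
      regroup : ∀ m l s s′ t t′ →
        l * l * ((m + l) * (m * s′ + l * t′)) + (m + l) * (l * s + m * t) ≡
        (m + l) * (l * (l * (m * s′)) + l * (l * (l * t′)) + l * s + m * t)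
      regroup = solve-∀ ℚ-ring
      collect : ∀ m l s t →
        (m + l) * (l * (l * (m * s)) + l * (l * (l * (l * l * t))) + l * (m * m * s) + m * (l * l * t)) ≡
        (m + l) * (m * l * (m + l) * s + m * l * l * t + l * t * (l * l * (l * l)))
      collect = solve-∀ ℚ-ring
      factor : ∀ m l s t →
        (m + l) * (m * l * (m + l) * s + m * l * l * t + l * t * (m * m)) ≡
        m * l * ((m + l) * (m + l) * (t + s))
      factor = solve-∀ ℚ-ring

-- The expansion bound along the recursion.

module FamilyExpansion where

  open Averages
  open Variance
  open Expanders
  open import Data.Rational using (_+_; _*_; _≤_; _<_)

  module _ {M D E F A B V : ℕ}
    .{{_ : NonZero M}} .{{_ : NonZero D}} .{{_ : NonZero E}} .{{_ : NonZero F}}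
    .{{_ : NonZero A}} .{{_ : NonZero B}} .{{_ : NonZero V}}
    .(eqE : D ℕ.* D ≡ E) .(eqF : E ℕ.* E ≡ F) .(eqM : F ℕ.* F ≡ M) .(eqV : (A ℕ.* B) ℕ.* M ≡ V)
    {Gₐ : Graph (Fin A) (Fin E)} {G_b : Graph (Fin B) (Fin E)} {H : Graph (Fin M) (Fin D)} where

    expansion-zigzagOf : ∀ {p m l} → 0ℚ ≤ p → 0ℚ < l → p * p ≤ m → l * l ≤ m →
      Expansion Gₐ p → Expansion G_b p → Expansion H l →
      Expansion (zigzagOf eqE eqF eqM eqV Gₐ G_b H) (m + l)
    expansion-zigzagOf {p} {m} {l} 0≤p 0<l p²≤m l²≤m Gₐ-p G_b-p H-l =
      expansion-cong (reindex vertices (pairs eqE) (zigzag large H)) (λ _ → refl)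
        (expansion-reindex (zigzag large H) vertices (pairs eqE) zigzag-expands)
      where
      vertices : ((Fin A × Fin B) × Fin M) ↔ Fin V
      vertices = ↔-trans (pairs refl ×-↔ ↔-refl) (pairs eqV)
      labels : ((Fin E × Fin E) × (Fin E × Fin E)) ↔ Fin M
      labels = ↔-trans (pairs eqF ×-↔ pairs eqF) (pairs eqM)
      large : Graph (Fin A × Fin B) (Fin M)
      large = reindex ↔-refl labels (square (Gₐ ⊗ G_b))

      square-expands : Expansion (square (Gₐ ⊗ G_b)) (p * p)
      square-expands = expansion-square (Gₐ ⊗ G_b) (expansion-⊗ {G₁ = Gₐ} {G₂ = G_b} Gₐ-p G_b-p)
      large-expands : Expansion large (p * p)
      large-expands = expansion-reindex (square (Gₐ ⊗ G_b)) ↔-refl labels square-expands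
      zigzag-expands : Expansion (zigzag large H) (m + l)
      zigzag-expands = expansion-zigzag {G₁ = large} {G₂ = H} 0<l l²≤m
        (expansion-mono large (0≤square p) p²≤m large-expands) H-l

  -- c = 5 and q ≤ 1/5 satisfy the hypotheses, which keep the bound
  -- q + c q² invariant under the recursion: (q + c q²)² ≤ (2q)² ≤ c q².
  module _ {D : ℕ} .{{_ : NonZero D}} {H : Graph (Fin (D ^ 8)) (Fin D)} {c q : ℚ}
    (1≤c : 1ℚ ≤ c) (4≤c : (1ℚ + 1ℚ) * (1ℚ + 1ℚ) ≤ c) (0<q : 0ℚ < q) (cq≤1 : c * q ≤ 1ℚ) where

    private
      V-finite : ∀ n → Finite (Fin (D ^ n))
      V-finite n = Fin-finite {{ℕₚ.m^n≢0 D n}}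

      r : ℚ
      r = q + c * (q * q)

      0≤q : 0ℚ ≤ q
      0≤q = ℚₚ.<⇒≤ 0<q
      0≤c : 0ℚ ≤ c
      0≤c = ℚₚ.≤-trans (ℚₚ.nonNegative⁻¹ 1ℚ) 1≤c
      0≤cq² : 0ℚ ≤ c * (q * q)
      0≤cq² = 0≤* 0≤c (0≤square q)
      q≤r : q ≤ r
      q≤r = ≤-of-diff _ 0≤cq² refl
      0≤r : 0ℚ ≤ r
      0≤r = ℚₚ.≤-trans 0≤q q≤r

      q²≤cq² : q * q ≤ c * (q * q)
      q²≤cq² = ℚₚ.≤-trans (ℚₚ.≤-reflexive (sym (ℚₚ.*-identityˡ (q * q)))) (*-monoˡ (q * q) (0≤square q) 1≤c)

      q²≤r : q * q ≤ r
      q²≤r = ℚₚ.≤-trans q²≤cq² (≤-of-diff q 0≤q (ℚₚ.+-comm q (c * (q * q))))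

      r²≤cq² : r * r ≤ c * (q * q)
      r²≤cq² = begin
        r * r
          ≤⟨ square-mono 0≤r (ℚₚ.≤-trans (ℚₚ.+-monoʳ-≤ q
               (ℚₚ.≤-trans (ℚₚ.≤-reflexive (sym (ℚₚ.*-assoc c q q))) (*-monoˡ q 0≤q cq≤1)))
               (ℚₚ.≤-reflexive (double q))) ⟩
        ((1ℚ + 1ℚ) * q) * ((1ℚ + 1ℚ) * q)
          ≡⟨ interchange (1ℚ + 1ℚ) q ⟩
        (1ℚ + 1ℚ) * (1ℚ + 1ℚ) * (q * q)
          ≤⟨ *-monoˡ (q * q) (0≤square q) 4≤c ⟩
        c * (q * q) ∎
        where
        open ℚₚ.≤-Reasoning
        double : ∀ q → q + 1ℚ * q ≡ (1ℚ + 1ℚ) * q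
        double = solve-∀ ℚ-ring
        interchange : ∀ t q → (t * q) * (t * q) ≡ t * t * (q * q)
        interchange = solve-∀ ℚ-ring

    familyAcc-expansion : Expansion {{V-finite 8}} H q → (t : ℕ) .{{_ : NonZero t}} (rs : Acc ℕ._<_ t) →
      Expansion {{V-finite (8 ℕ.* t)}} {{V-finite 2}} (familyAcc H t rs) (q + c * (q * q))
    familyAcc-expansion H-q 1 _ =
      expansion-cong {{V-finite 8}} {{V-finite 2}} G (λ _ → refl)
        (expansion-mono {{V-finite 8}} {{V-finite 2}} G (0≤square q) q²≤r
          (expansion-reindex {{V-finite 8}} {{×-finite}} (square H) {{V-finite 8}} {{V-finite 2}}
            ↔-refl (pairs (D*D≡D² D)) (expansion-square {{V-finite 8}} H H-q)))
      where
      G : Graph (Fin (D ^ 8)) (Fin (D ^ 2))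
      G = reindex ↔-refl (pairs (D*D≡D² D)) (square H)
    familyAcc-expansion H-q 2 _ =
      expansion-cong {{V-finite 16}} {{V-finite 2}} G (λ _ → refl)
        (expansion-mono {{V-finite 16}} {{V-finite 2}} G 0≤q q≤r
          (expansion-reindex {{×-finite {{V-finite 8}} {{V-finite 8}}}} {{×-finite}} (H ⊗ H)
            {{V-finite 16}} {{V-finite 2}} (pairs (^-+ D 8 8)) (pairs (D*D≡D² D))
            (expansion-⊗ {{V-finite 8}} {{V-finite 8}} {G₁ = H} {G₂ = H} H-q H-q)))
      where
      G : Graph (Fin (D ^ 16)) (Fin (D ^ 2))
      G = reindex (pairs (^-+ D 8 8)) (pairs (D*D≡D² D)) (H ⊗ H)
    familyAcc-expansion H-q (suc (suc (suc s))) (acc rs) =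
      expansion-cong {{V-finite (8 ℕ.* (3 ℕ.+ s))}} {{V-finite 2}} large (λ _ → refl)
        (subst (Expansion {{V-finite (8 ℕ.* (3 ℕ.+ s))}} {{V-finite 2}} large)
        (ℚₚ.+-comm (c * (q * q)) q)
        (expansion-zigzagOf
          {M = D ^ 8} {D = D} {E = D ^ 2} {F = D ^ 4} {A = D ^ (8 ℕ.* a)} {B = D ^ (8 ℕ.* b)}
          {V = D ^ (8 ℕ.* (3 ℕ.+ s))}
          {{ℕₚ.m^n≢0 D 8}} {{it}} {{ℕₚ.m^n≢0 D 2}} {{ℕₚ.m^n≢0 D 4}}
          {{ℕₚ.m^n≢0 D (8 ℕ.* a)}} {{ℕₚ.m^n≢0 D (8 ℕ.* b)}} {{ℕₚ.m^n≢0 D (8 ℕ.* (3 ℕ.+ s))}}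
          (D*D≡D² D) (^-+ D 2 2) (^-+ D 4 4) (vertices-eq D (suc s)) {Gₐ} {G_b} {H}
          -- The zig-zag bound is used with `m = c q²` and `l = q`, so that `m + l` is again `r`;
          -- `r²≤cq²` covers the large graph and `q²≤cq²` is the condition `l² ≤ m`.
          0≤r 0<q r²≤cq² q²≤cq²
          (familyAcc-expansion H-q a (rs (ℕₚ.m<n⇒m<1+n (ℕₚ.⌈n/2⌉<n s))))
          (familyAcc-expansion H-q b (rs (ℕₚ.m<n⇒m<1+n (ℕₚ.⌊n/2⌋<n (suc s)))))
          H-q))
      where
      a b : ℕ
      a = ℕ.⌈ 2 ℕ.+ s /2⌉
      b = ℕ.⌊ 2 ℕ.+ s /2⌋
      Gₐ : Graph (Fin (D ^ (8 ℕ.* a))) (Fin (D ^ 2))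
      Gₐ = familyAcc H a (rs (ℕₚ.m<n⇒m<1+n (ℕₚ.⌈n/2⌉<n s)))
      G_b : Graph (Fin (D ^ (8 ℕ.* b))) (Fin (D ^ 2))
      G_b = familyAcc H b (rs (ℕₚ.m<n⇒m<1+n (ℕₚ.⌊n/2⌋<n (suc s))))
      large : Graph (Fin (D ^ (8 ℕ.* (3 ℕ.+ s)))) (Fin (D ^ 2))
      large = zigzagOf (D*D≡D² D) (^-+ D 2 2) (^-+ D 4 4) (vertices-eq D (suc s)) Gₐ G_b H

  5ℚ : ℚ
  5ℚ = (+ 5) ℚ./ 1

  family-expansion : ∀ {D} .{{_ : NonZero D}} {H : Graph (Fin (D ^ 8)) (Fin D)} {q} → 0ℚ < q →
    Expansion {{Fin-finite {{ℕₚ.m^n≢0 D 8}}}} H q → (t : ℕ) .{{_ : NonZero t}} →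
    Expansion {{Fin-finite {{ℕₚ.m^n≢0 D (8 ℕ.* t)}}}} {{Fin-finite {{ℕₚ.m^n≢0 D 2}}}}
      (family H t) (q + 5ℚ * 5ℚ * (q * q))
  family-expansion {D} {H} {q} 0<q H-q t with ℚₚ.≤-total (5ℚ * q) 1ℚ
  ... | inj₁ 5q≤1 = expansion-mono {{V-finite}} {{L-finite}} (family H t) (0≤+ 0≤q (0≤* 0≤5 (0≤square q)))
      (ℚₚ.+-monoʳ-≤ q (*-monoˡ (q * q) {5ℚ} {5ℚ * 5ℚ} (0≤square q) (ℚ.*≤* (ℤ.+≤+ (ℕₚ.≤ᵇ⇒≤ 5 25 _)))))
      (familyAcc-expansion {H = H} {c = 5ℚ} {q = q} (ℚ.*≤* (ℤ.+≤+ (ℕₚ.≤ᵇ⇒≤ 1 5 _))) (ℚ.*≤* (ℤ.+≤+ (ℕₚ.≤ᵇ⇒≤ 4 5 _)))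
        0<q 5q≤1 H-q t (<-wellFounded t))
    where
    V-finite : Finite (Fin (D ^ (8 ℕ.* t)))
    V-finite = Fin-finite {{ℕₚ.m^n≢0 D (8 ℕ.* t)}}
    L-finite : Finite (Fin (D ^ 2))
    L-finite = Fin-finite {{ℕₚ.m^n≢0 D 2}}
    0≤q : 0ℚ ≤ q
    0≤q = ℚₚ.<⇒≤ 0<q
    0≤5 : 0ℚ ≤ 5ℚ
    0≤5 = ℚₚ.nonNegative⁻¹ 5ℚ
  ... | inj₂ 1≤5q = expansion-mono {{V-finite}} {{L-finite}} (family H t) (ℚₚ.nonNegative⁻¹ 1ℚ)
      (begin
        1ℚ                       ≤⟨ square-mono (ℚₚ.nonNegative⁻¹ 1ℚ) 1≤5q ⟩
        (5ℚ * q) * (5ℚ * q)      ≡⟨ interchange 5ℚ q ⟩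
        5ℚ * 5ℚ * (q * q)        ≤⟨ ≤-of-diff q (ℚₚ.<⇒≤ 0<q) (ℚₚ.+-comm q _) ⟩
        q + 5ℚ * 5ℚ * (q * q)    ∎)
      (expansion-1 {{V-finite}} {{L-finite}} (family H t))
    where
    open ℚₚ.≤-Reasoning
    V-finite : Finite (Fin (D ^ (8 ℕ.* t)))
    V-finite = Fin-finite {{ℕₚ.m^n≢0 D (8 ℕ.* t)}}
    L-finite : Finite (Fin (D ^ 2))
    L-finite = Fin-finite {{ℕₚ.m^n≢0 D 2}}
    interchange : ∀ t q → (t * q) * (t * q) ≡ t * t * (q * q)
    interchange = solve-∀ ℚ-ring

-- The adjacency matrix as an averaging operator.

module Adjacency where

  open Averages
  open Variance
  open Expanders
  open import Data.Rational using (_+_; _*_)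

  listSum : ∀ {A : Set} → (A → ℚ) → List A → ℚ
  listSum f []       = 0ℚ
  listSum f (x ∷ xs) = f x + listSum f xs

  length-filter : ∀ {A : Set} {P : A → Set} (P? : Decidable P) d .{{_ : NonZero d}} xs →
    (+ length (filter P? xs)) ℚ./ d ≡ listSum (λ x → if does (P? x) then recip d else 0ℚ) xs
  length-filter P? d []       = 0/ d
  length-filter P? d (x ∷ xs) with does (P? x)
  ... | false = trans (length-filter P? d xs) (sym (ℚₚ.+-identityˡ _))
  ... | true  = trans (/-suc (length (filter P? xs)) d) (cong (λ z → recip d + z) (length-filter P? d xs))

  listSum-++ : ∀ {A : Set} (f : A → ℚ) xs ys → listSum f (xs List.++ ys) ≡ listSum f xs + listSum f ys
  listSum-++ f []       ys = sym (ℚₚ.+-identityˡ _)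
  listSum-++ f (x ∷ xs) ys = trans (cong (λ z → f x + z) (listSum-++ f xs ys))
    (sym (ℚₚ.+-assoc (f x) (listSum f xs) (listSum f ys)))

  listSum-map : ∀ {A B : Set} (f : B → ℚ) (g : A → B) xs → listSum f (List.map g xs) ≡ listSum (f ∘ g) xs
  listSum-map f g []       = refl
  listSum-map f g (x ∷ xs) = cong (λ z → f (g x) + z) (listSum-map f g xs)

  listSum-cartesianProduct : ∀ {A B : Set} (f : A × B → ℚ) xs ys →
    listSum f (cartesianProduct xs ys) ≡ listSum (λ x → listSum (λ y → f (x , y)) ys) xs
  listSum-cartesianProduct f []       ys = refl
  listSum-cartesianProduct f (x ∷ xs) ys =
    trans (listSum-++ f (List.map (x ,_) ys) (cartesianProduct xs ys))
      (cong₂ _+_ (listSum-map f (x ,_) ys) (listSum-cartesianProduct f xs ys))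

  listSum-tabulate : ∀ {A : Set} {n} (f : A → ℚ) (g : Fin n → A) → listSum f (tabulate g) ≡ sum (f ∘ g)
  listSum-tabulate {n = zero}  f g = refl
  listSum-tabulate {n = suc n} f g = cong (λ z → f (g zero) + z) (listSum-tabulate f (g ∘ suc))

  sum-single : ∀ {n} (f : Fin n → ℚ) k → (∀ i → i ≢ k → f i ≡ 0ℚ) → sum f ≡ f k
  sum-single f zero    f≡0 = trans
    (cong (λ z → f zero + z) (sum-zero (f ∘ suc) λ i → f≡0 (suc i) λ ())) (ℚₚ.+-identityʳ (f zero))
  sum-single f (suc k) f≡0 = trans
    (cong₂ _+_ (f≡0 zero λ ()) (sum-single (f ∘ suc) k λ i i≢k → f≡0 (suc i) (i≢k ∘ Finₚ.suc-injective)))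
    (ℚₚ.+-identityˡ (f (suc k)))

  module _ {N D : ℕ} .{{_ : NonZero D}} (G : Graph (Fin N) (Fin D)) where

    hit : Fin N × Fin D → Fin N → Fin D → ℚ
    hit e v j = if does (≡-dec Finₚ._≟_ Finₚ._≟_ e (v , j)) then recip D else 0ℚ

    hit-≡ : ∀ v j → hit (v , j) v j ≡ recip D
    hit-≡ v j = cong (if_then recip D else 0ℚ) (dec-true (≡-dec Finₚ._≟_ Finₚ._≟_ (v , j) (v , j)) refl)

    hit-≢ : ∀ e v j → e ≢ (v , j) → hit e v j ≡ 0ℚ
    hit-≢ e v j e≢ = cong (if_then recip D else 0ℚ) (dec-false (≡-dec Finₚ._≟_ Finₚ._≟_ e (v , j)) e≢)

    edges-sum : ∀ u v → (+ edges G u v) ℚ./ D ≡ sum λ i → sum λ j → hit (rot G (u , i)) v j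
    edges-sum u v = begin
      (+ edges G u v) ℚ./ D
        ≡⟨ length-filter (λ (i , j) → ≡-dec Finₚ._≟_ Finₚ._≟_ (rot G (u , i)) (v , j)) D
             (cartesianProduct (allFin D) (allFin D)) ⟩
      listSum (λ (i , j) → hit (rot G (u , i)) v j) (cartesianProduct (allFin D) (allFin D))
        ≡⟨ listSum-cartesianProduct (λ (i , j) → hit (rot G (u , i)) v j) (allFin D) (allFin D) ⟩
      listSum (λ i → listSum (λ j → hit (rot G (u , i)) v j) (allFin D)) (allFin D)
        ≡⟨ listSum-tabulate (λ i → listSum (λ j → hit (rot G (u , i)) v j) (allFin D)) (λ i → i) ⟩
      sum (λ i → listSum (λ j → hit (rot G (u , i)) v j) (allFin D))
        ≡⟨ sum-cong-≗ (λ i → listSum-tabulate (λ j → hit (rot G (u , i)) v j) (λ j → j)) ⟩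
      sum (λ i → sum λ j → hit (rot G (u , i)) v j) ∎
      where open ≡-Reasoning

    sum-hit : ∀ (f : Fin N → ℚ) e → sum (λ v → sum (λ j → hit e v j) * f v) ≡ recip D * f (proj₁ e)
    sum-hit f (w , k) = begin
      sum (λ v → sum (λ j → hit (w , k) v j) * f v)
        ≡⟨ sum-single (λ v → sum (λ j → hit (w , k) v j) * f v) w (λ v v≢w → trans
             (cong (_* f v) (sum-zero (hit (w , k) v) λ j → hit-≢ (w , k) v j (v≢w ∘ sym ∘ ,-injectiveˡ)))
             (ℚₚ.*-zeroˡ (f v))) ⟩
      sum (λ j → hit (w , k) w j) * f w
        ≡⟨ cong (_* f w) (trans
             (sum-single (hit (w , k) w) k (λ j j≢k → hit-≢ (w , k) w j (j≢k ∘ sym ∘ ,-injectiveʳ))) (hit-≡ w k)) ⟩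
      recip D * f w ∎
      where open ≡-Reasoning

    -- Each label `i` at `u` is counted for exactly one pair `(v , j)`, namely `rot G (u , i)`.
    -- Exchanging the sums therefore leaves one value of `f` per label.
    adjacency-walk : ∀ (f : Fin N → ℚ) u →
      sum (λ v → (+ edges G u v) ℚ./ D * f v) ≡ walk G f u
    adjacency-walk f u = begin
      sum (λ v → (+ edges G u v) ℚ./ D * f v)
        ≡⟨ sum-cong-≗ (λ v → trans (cong (_* f v) (edges-sum u v))
             (*-distribʳ-sum (f v) (λ i → sum λ j → hit (rot G (u , i)) v j))) ⟩
      sum (λ v → sum λ i → sum (λ j → hit (rot G (u , i)) v j) * f v)
        ≡⟨ ∑-comm (λ v i → sum (λ j → hit (rot G (u , i)) v j) * f v) ⟩
      sum (λ i → sum λ v → sum (λ j → hit (rot G (u , i)) v j) * f v)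
        ≡⟨ sum-cong-≗ (λ i → sum-hit f (rot G (u , i))) ⟩
      sum (λ i → recip D * f (proj₁ (rot G (u , i))))
        ≡⟨ *-distribˡ-sum (recip D) (λ i → f (proj₁ (rot G (u , i)))) ⟨
      recip D * sum (λ i → f (proj₁ (rot G (u , i))))
        ≡⟨ 𝔼-Fin (λ i → f (proj₁ (rot G (u , i)))) ⟨
      walk G f u ∎
      where open ≡-Reasoning

  -- The real operations act termwise, so at stage `n` a statement about real vectors is one about
  -- rational vectors.
  seq-Σ : ∀ {N} (f : Fin N → ℝ) n → seq (Σℝ f) n ≡ sum (λ i → seq (f i) n)
  seq-Σ {zero}  f n = refl
  seq-Σ {suc N} f n = cong (λ z → seq (f zero) n + z) (seq-Σ (f ∘ suc) n)

  seq-norm : ∀ {N} (α : Fin N → ℝ) n → seq ‖ α ‖² n ≡ sum (λ v → seq (α v) n * seq (α v) n)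
  seq-norm α n = seq-Σ (λ v → α v Defs.* α v) n

  seq-mean : ∀ {N} (α : Fin N → ℝ) n → seq ⟨ α , 𝟙 ⟩ n ≡ sum (λ v → seq (α v) n)
  seq-mean α n = trans (seq-Σ (λ v → α v Defs.* 𝟙 v) n)
    (sum-cong-≗ λ v → ℚₚ.*-identityʳ (seq (α v) n))

  seq-adjacency : ∀ {N D} .{{_ : NonZero D}} (G : Graph (Fin N) (Fin D)) (α : Fin N → ℝ) n →
    seq ‖ adjacency G · α ‖² n ≡
      sum (λ u → walk G (λ v → seq (α v) n) u * walk G (λ v → seq (α v) n) u)
  seq-adjacency {N} G α n = trans (seq-norm (adjacency G · α) n)
    (sum-cong-≗ {N} λ u → cong₂ _*_ (walk-at u) (walk-at u))
    where
    walk-at : ∀ u → seq ((adjacency G · α) u) n ≡ walk G (λ v → seq (α v) n) u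
    walk-at u = trans (seq-Σ (λ v → adjacency G u v Defs.* α v) n)
      (adjacency-walk G (λ v → seq (α v) n) u)

-- Translation between real norms and rational variances.

module Bridge where

  open Averages
  open Variance
  open Expanders
  open Adjacency
  open import Data.Rational using (_+_; _*_; _-_; -_; _≤_; _<_)

  ≤-of-approx : ∀ {p q} → (∀ ε → 0ℚ < ε → p ≤ q + ε) → p ≤ q
  ≤-of-approx {p} {q} p≤q+ε = ℚₚ.≮⇒≥ λ q<p →
    let 0<d = subst (_< p - q) (ℚₚ.+-inverseʳ q) (ℚₚ.+-monoˡ-< (- q) q<p)
        h   = ½ * (p - q)
        0<h = half-pos (p - q) 0<d
        open ℚₚ.≤-Reasoning
    in ℚₚ.<-irrefl refl (begin-strict
      p                ≤⟨ p≤q+ε h 0<h ⟩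
      q + h            ≡⟨ ℚₚ.+-identityʳ (q + h) ⟨
      q + h + 0ℚ       <⟨ ℚₚ.+-monoʳ-< (q + h) 0<h ⟩
      q + h + h        ≡⟨ ℚₚ.+-assoc q h h ⟩
      q + (h + h)      ≡⟨ cong (λ z → q + z) (halves (p - q)) ⟩
      q + (p - q)      ≡⟨ add-back q p ⟩
      p                ∎)
    where
    add-back : ∀ q p → q + (p - q) ≡ p
    add-back = solve-∀ ℚ-ring

  p≤∣p∣ : ∀ p → p ≤ ∣ p ∣
  p≤∣p∣ p with ℚₚ.≤-total 0ℚ p
  ... | inj₁ 0≤p = ℚₚ.≤-reflexive (sym (ℚₚ.0≤p⇒∣p∣≡p 0≤p))
  ... | inj₂ p≤0 = ℚₚ.≤-trans p≤0 (ℚₚ.0≤∣p∣ p)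

  ∣∣-+ : ∀ {p q P Q} → ∣ p ∣ ≤ P → ∣ q ∣ ≤ Q → ∣ p + q ∣ ≤ P + Q
  ∣∣-+ {p} {q} p≤P q≤Q = ℚₚ.≤-trans (ℚₚ.∣p+q∣≤∣p∣+∣q∣ p q) (ℚₚ.+-mono-≤ p≤P q≤Q)

  ∣∣-* : ∀ {p q P Q} → ∣ p ∣ ≤ P → ∣ q ∣ ≤ Q → ∣ p * q ∣ ≤ P * Q
  ∣∣-* {p} {q} {P} p≤P q≤Q = ℚₚ.≤-trans (ℚₚ.≤-reflexive (ℚₚ.∣p*q∣≡∣p∣*∣q∣ p q))
    (ℚₚ.≤-trans (*-monoˡ ∣ q ∣ (ℚₚ.0≤∣p∣ q) p≤P) (*-monoʳ P (ℚₚ.≤-trans (ℚₚ.0≤∣p∣ p) p≤P) q≤Q))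

  -- The assumptions say that `p` lies between `-q` and `q`. The form allows negative `p`: the
  -- approximations of a nonnegative real may lie slightly below zero.
  square≤ : ∀ {p q} → 0ℚ ≤ p + q → p ≤ q → p * p ≤ q * q
  square≤ {p} {q} 0≤p+q p≤q = ≤-of-diff ((p + q) * (q - p))
    (0≤* 0≤p+q (subst (_≤ q - p) (ℚₚ.+-inverseʳ p) (ℚₚ.+-monoˡ-≤ (- p) p≤q))) (difference p q)
    where
    difference : ∀ p q → q * q ≡ p * p + (p + q) * (q - p)
    difference = solve-∀ ℚ-ring

  small : ∀ {a} → 0ℚ < a → ∃ λ δ → 0ℚ < δ × δ ≤ 1ℚ × δ ≤ a
  small {a} 0<a with ℚₚ.≤-total a 1ℚ
  ... | inj₁ a≤1 = a , 0<a , a≤1 , ℚₚ.≤-refl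
  ... | inj₂ 1≤a = 1ℚ , ℚₚ.positive⁻¹ 1ℚ , ℚₚ.≤-refl , 1≤a

  -- Stronger than `μ ≤ q` between reals, which would leave a slack ε in every tail.
  EventuallyBelow : ℝ → ℚ → Set
  EventuallyBelow μ q = ∃ λ n₀ → ∀ n → n₀ ℕ.≤ n → seq μ n ≤ q

  count : ℕ → ℚ
  count n = sum {n} (λ _ → 1ℚ)

  module _ {N : ℕ} .{{_ : NonZero N}} where

    recip*count : recip N * count N ≡ 1ℚ
    recip*count = trans (sym (𝔼-Fin {N} (λ _ → 1ℚ))) 𝔼-1

    sum-𝔼 : (f : Fin N → ℚ) → sum f ≡ count N * 𝔼 f
    sum-𝔼 f = begin
      sum f                        ≡⟨ ℚₚ.*-identityˡ (sum f) ⟨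
      1ℚ * sum f                   ≡⟨ cong (_* sum f) recip*count ⟨
      recip N * count N * sum f       ≡⟨ swap-factors (recip N) (count N) (sum f) ⟩
      count N * (recip N * sum f)     ≡⟨ cong (count N *_) (𝔼-Fin f) ⟨
      count N * 𝔼 f                   ∎
      where
      open ≡-Reasoning
      swap-factors : ∀ r c s → r * c * s ≡ c * (r * s)
      swap-factors = solve-∀ ℚ-ring

    0≤count : 0ℚ ≤ count N
    0≤count = 0≤sum {N} λ _ → ℚₚ.nonNegative⁻¹ 1ℚ

    -- The left side is the right side divided by `N`. The loss is harmless, as the sum serves only
    -- as an error tending to zero.
    count*𝔼²≤sum² : (f : Fin N → ℚ) → count N * (𝔼 f * 𝔼 f) ≤ sum f * sum f
    count*𝔼²≤sum² f = begin
      count N * (𝔼 f * 𝔼 f)                ≡⟨ ℚₚ.*-identityˡ _ ⟨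
      1ℚ * (count N * (𝔼 f * 𝔼 f))         ≤⟨ *-monoˡ _ (0≤* 0≤count (0≤square (𝔼 f))) 1≤count ⟩
      count N * (count N * (𝔼 f * 𝔼 f))    ≡⟨ interchange (count N) (𝔼 f) ⟩
      (count N * 𝔼 f) * (count N * 𝔼 f)    ≡⟨ cong₂ _*_ (sum-𝔼 f) (sum-𝔼 f) ⟨
      sum f * sum f                        ∎
      where
      open ℚₚ.≤-Reasoning
      interchange : ∀ s e → s * (s * (e * e)) ≡ (s * e) * (s * e)
      interchange = solve-∀ ℚ-ring
      1≤sum : ∀ n .{{_ : NonZero n}} → 1ℚ ≤ count n
      1≤sum (suc n) = ≤-of-diff (count n) (0≤sum {n} λ _ → ℚₚ.nonNegative⁻¹ 1ℚ) refl
      1≤count : 1ℚ ≤ count N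
      1≤count = 1≤sum N

  module _ {N D : ℕ} .{{_ : NonZero N}} .{{_ : NonZero D}} (G : Graph (Fin N) (Fin D)) where

    -- The real bound is tested on the constant sequences `f - 𝔼 f`, which are exactly orthogonal to
    -- `𝟙`. Only `μ` and ε then depend on the stage; a late stage replaces `μ` by `q`, and ε is
    -- arbitrary.
    expansion-of-IsExpander : ∀ {μ q} → 0ℚ < q → EventuallyBelow μ q → IsExpander G μ → Expansion G q
    contraction (expansion-of-IsExpander {μ} {q} 0<q (n₁ , μ≤q) (0≤μ , bound)) f = begin
      Var (walk G f)
        ≡⟨ Var-centred (walk G f) ⟩
      𝔼 (λ u → (walk G f u - 𝔼 (walk G f)) * (walk G f u - 𝔼 (walk G f)))
        ≡⟨ 𝔼-cong (λ u → cong₂ _*_ (centred u) (centred u)) ⟩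
      𝔼 (λ u → walk G β u * walk G β u)
        ≡⟨ 𝔼-Fin (λ u → walk G β u * walk G β u) ⟩
      recip N * sum (λ u → walk G β u * walk G β u)
        ≤⟨ *-monoʳ (recip N) (0≤recip N) (≤-of-approx approx) ⟩
      recip N * (q * q * sum (λ v → β v * β v))
        ≡⟨ swap-factors (recip N) (q * q) (sum (λ v → β v * β v)) ⟩
      q * q * (recip N * sum (λ v → β v * β v))
        ≡⟨ cong (q * q *_) (𝔼-Fin (λ v → β v * β v)) ⟨
      q * q * 𝔼 (λ v → β v * β v)
        ≡⟨ cong (q * q *_) (Var-centred f) ⟨
      q * q * Var f ∎
      where
      open ℚₚ.≤-Reasoning
      β : Fin N → ℚ
      β v = f v - 𝔼 f
      swap-factors : ∀ r c s → r * (c * s) ≡ c * (r * s)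
      swap-factors = solve-∀ ℚ-ring
      centred : ∀ u → walk G f u - 𝔼 (walk G f) ≡ walk G β u
      centred u = trans (cong (λ z → walk G f u - z) (𝔼-walk G f))
        (sym (𝔼-sub (λ i → f (proj₁ (rot G (u , i)))) (𝔼 f)))
      α : Fin N → ℝ
      α v = fromℚ (β v)
      mean≡0 : ∀ n → seq ⟨ α , 𝟙 ⟩ n ≡ 0ℚ
      mean≡0 n = trans (seq-mean α n) (trans (sum-𝔼 β)
        (trans (cong (count N *_) (trans (𝔼-sub f (𝔼 f)) (ℚₚ.+-inverseʳ (𝔼 f)))) (ℚₚ.*-zeroʳ (count N))))
      mean≈0 : ⟨ α , 𝟙 ⟩ Defs.≈ 0ℝ
      mean≈0 =
        (λ ε 0<ε → 0 , λ n _ → ℚₚ.≤-trans (ℚₚ.≤-reflexive (mean≡0 n)) (≤-of-diff ε (ℚₚ.<⇒≤ 0<ε) refl)) ,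
        (λ ε 0<ε → 0 , λ n _ → ≤-of-diff ε (ℚₚ.<⇒≤ 0<ε) (cong (_+ ε) (mean≡0 n)))
      approx : ∀ ε → 0ℚ < ε →
        sum (λ u → walk G β u * walk G β u) ≤ q * q * sum (λ v → β v * β v) + ε
      approx ε 0<ε =
        -- Nonnegativity of `μ` with tolerance `q` is the lower bound that `square≤` asks for; this
        -- needs `0 < q`.
        let (n₂ , 0≤μ+q) = 0≤μ q 0<q
            (n₃ , close) = bound α mean≈0 ε 0<ε
            n   = n₁ ℕ.⊔ n₂ ℕ.⊔ n₃
            n₁₂ = ℕₚ.m≤m⊔n (n₁ ℕ.⊔ n₂) n₃
        in begin
          sum (λ u → walk G β u * walk G β u)
            ≡⟨ seq-adjacency G α n ⟨
          seq ‖ adjacency G · α ‖² n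
            ≤⟨ close n (ℕₚ.m≤n⊔m (n₁ ℕ.⊔ n₂) n₃) ⟩
          seq μ n * seq μ n * seq ‖ α ‖² n + ε
            ≡⟨ cong (λ z → seq μ n * seq μ n * z + ε) (seq-norm α n) ⟩
          seq μ n * seq μ n * sum (λ v → β v * β v) + ε
            ≤⟨ ℚₚ.+-monoˡ-≤ ε (*-monoˡ _ sum-squares≥0
                 (square≤ (0≤μ+q n (ℕₚ.≤-trans (ℕₚ.m≤n⊔m n₁ n₂) n₁₂))
                          (μ≤q n (ℕₚ.≤-trans (ℕₚ.m≤m⊔n n₁ n₂) n₁₂)))) ⟩
          q * q * sum (λ v → β v * β v) + ε ∎
        where
        sum-squares≥0 : 0ℚ ≤ sum (λ v → β v * β v)
        sum-squares≥0 = 0≤sum λ v → 0≤square (β v)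

    -- The second moment of the walk is its variance plus the squared mean. The mean is kept as an
    -- error term because the approximations of an orthogonal vector need not be orthogonal.
    expansion-sum : ∀ {r} → Expansion G r → (f : Fin N → ℚ) →
      sum (λ u → walk G f u * walk G f u) ≤ r * r * sum (λ v → f v * f v) + sum f * sum f
    expansion-sum {r} G-r f = begin
      sum (λ u → walk G f u * walk G f u)
        ≡⟨ sum-𝔼 (λ u → walk G f u * walk G f u) ⟩
      count N * 𝔼 (λ u → walk G f u * walk G f u)
        ≡⟨ cong (count N *_) (add-back (𝔼 (λ u → walk G f u * walk G f u)) (𝔼 (walk G f) * 𝔼 (walk G f))) ⟩
      count N * (Var (walk G f) + 𝔼 (walk G f) * 𝔼 (walk G f))
        ≡⟨ cong (λ z → count N * (Var (walk G f) + z * z)) (𝔼-walk G f) ⟩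
      count N * (Var (walk G f) + 𝔼 f * 𝔼 f)
        ≤⟨ *-monoʳ (count N) 0≤count (ℚₚ.+-monoˡ-≤ (𝔼 f * 𝔼 f) (ℚₚ.≤-trans (contraction G-r f)
             (*-monoʳ (r * r) (0≤square r) (≤-of-diff (𝔼 f * 𝔼 f) (0≤square (𝔼 f))
               (add-back (𝔼 (λ v → f v * f v)) (𝔼 f * 𝔼 f)))))) ⟩
      count N * (r * r * 𝔼 (λ v → f v * f v) + 𝔼 f * 𝔼 f)
        ≡⟨ distribute (count N) (r * r) (𝔼 (λ v → f v * f v)) (𝔼 f * 𝔼 f) ⟩
      r * r * (count N * 𝔼 (λ v → f v * f v)) + count N * (𝔼 f * 𝔼 f)
        ≡⟨ cong (λ z → r * r * z + count N * (𝔼 f * 𝔼 f)) (sum-𝔼 (λ v → f v * f v)) ⟨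
      r * r * sum (λ v → f v * f v) + count N * (𝔼 f * 𝔼 f)
        ≤⟨ ℚₚ.+-monoʳ-≤ (r * r * sum (λ v → f v * f v)) (count*𝔼²≤sum² f) ⟩
      r * r * sum (λ v → f v * f v) + sum f * sum f ∎
      where
      open ℚₚ.≤-Reasoning
      add-back : ∀ x y → x ≡ x - y + y
      add-back = solve-∀ ℚ-ring
      distribute : ∀ s r x y → s * (r * x + y) ≡ r * (s * x) + s * y
      distribute = solve-∀ ℚ-ring

-- The limit of q tending to μ.

module Continuity where

  open Averages
  open Variance
  open Expanders
  open Adjacency
  open Bridge
  open FamilyExpansion
  open import Data.Rational using (_+_; _*_; _-_; _≤_; _<_)

  module _ {N D : ℕ} .{{_ : NonZero N}} .{{_ : NonZero D}} (G : Graph (Fin N) (Fin D))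
    {c : ℚ} (0≤c : 0ℚ ≤ c) (μ : ℝ) where

    private
      φ : ℚ → ℚ
      φ x = x + c * (x * x)

      -- (φ (x + δ))² − (φ x)² = δ · slope δ x
      slope : ℚ → ℚ → ℚ
      slope δ x = (1ℚ + c * (x + (x + δ))) * (φ (x + δ) + φ x)

      φ²-increment : ∀ δ x → φ (x + δ) * φ (x + δ) ≡ φ x * φ x + δ * slope δ x
      φ²-increment δ x = identity c δ x
        where
        identity : ∀ c δ x → ((x + δ) + c * ((x + δ) * (x + δ))) * ((x + δ) + c * ((x + δ) * (x + δ))) ≡
          (x + c * (x * x)) * (x + c * (x * x)) +
          δ * ((1ℚ + c * (x + (x + δ))) * (((x + δ) + c * ((x + δ) * (x + δ))) + (x + c * (x * x))))
        identity = solve-∀ ℚ-ring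

      -- The formula of `slope` with `x` and `x + δ` both replaced by a common bound `b` on their
      -- absolute values.
      slopeBound : ℚ → ℚ
      slopeBound b = (1ℚ + c * (b + b)) * (φ b + φ b)

      slope≤ : ∀ {δ x b} → ∣ x ∣ ≤ b → ∣ x + δ ∣ ≤ b → slope δ x ≤ slopeBound b
      slope≤ {δ} {x} x≤b q≤b = ℚₚ.≤-trans (p≤∣p∣ (slope δ x))
        (∣∣-* (∣∣-+ {1ℚ} ℚₚ.≤-refl (∣∣-* ∣c∣≤c (∣∣-+ x≤b q≤b)))
              (∣∣-+ (∣∣-+ q≤b (∣∣-* ∣c∣≤c (∣∣-* q≤b q≤b))) (∣∣-+ x≤b (∣∣-* ∣c∣≤c (∣∣-* x≤b x≤b)))))
        where
        ∣c∣≤c : ∣ c ∣ ≤ c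
        ∣c∣≤c = ℚₚ.≤-reflexive (ℚₚ.0≤p⇒∣p∣≡p 0≤c)

      0<slopeBound : ∀ {b} → 0ℚ < b → 0ℚ < slopeBound b
      0<slopeBound {b} 0<b = 0<*
        (ℚₚ.+-mono-<-≤ (ℚₚ.positive⁻¹ 1ℚ) (0≤* 0≤c (ℚₚ.<⇒≤ (ℚₚ.+-mono-< 0<b 0<b))))
        (ℚₚ.+-mono-< 0<φb 0<φb)
        where
        0<φb : 0ℚ < φ b
        0<φb = ℚₚ.+-mono-<-≤ 0<b (0≤* 0≤c (0≤square b))

    IsExpander-of-expansion : 0ℝ Defs.≤ μ →
      (∀ q → 0ℚ < q → EventuallyBelow μ q → Expansion G (q + c * (q * q))) →
      IsExpander G (μ Defs.+ fromℚ c Defs.* (μ Defs.* μ))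
    IsExpander-of-expansion 0≤μ G-expands = nonneg , bound
      where
      nonneg : 0ℝ Defs.≤ (μ Defs.+ fromℚ c Defs.* (μ Defs.* μ))
      nonneg ε 0<ε = let (n₀ , 0≤μ+ε) = 0≤μ ε 0<ε in n₀ , λ n n₀≤n →
        ℚₚ.≤-trans (0≤μ+ε n n₀≤n) (ℚₚ.+-monoˡ-≤ ε
          (≤-of-diff {seq μ n} {φ (seq μ n)} (c * (seq μ n * seq μ n))
            (0≤* 0≤c (0≤square (seq μ n))) refl))

      -- At stage n the hypothesis is used with q = μₙ + δ.
      bound : ∀ (α : Fin N → ℝ) → ⟨ α , 𝟙 ⟩ Defs.≈ 0ℝ →
        ‖ adjacency G · α ‖² Defs.≤
          ((μ Defs.+ fromℚ c Defs.* (μ Defs.* μ)) Defs.* (μ Defs.+ fromℚ c Defs.* (μ Defs.* μ))) Defs.* ‖ α ‖²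
      bound α (mean≤0 , 0≤mean) ε 0<ε =
        let 0<½ε = half-pos ε 0<ε
            -- Half of ε pays for the error `s²`, at most `η² ≤ η`; the other half for replacing
            -- `μₙ` by `μₙ + δ`, at most `δ * R * K`.
            (η , 0<η , η≤1 , η≤½ε)       = small 0<½ε
            (B , 0<B , n₁ , μ<B)         = eventually-bounded μ
            (K , 0<K , n₂ , ‖α‖²<K)      = eventually-bounded ‖ α ‖²
            -- As `δ ≤ 1`, this bounds both `μₙ` and `μₙ + δ`.
            b     = B + 1ℚ
            0<b   = ℚₚ.+-mono-< 0<B (ℚₚ.positive⁻¹ 1ℚ)
            R     = slopeBound b
            0<R   = 0<slopeBound 0<b
            (δ′ , 0<δ′ , RKδ′≡½ε)        = divide (R * K) (½ * ε) (0<* 0<R 0<K) 0<½ε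
            (δ , 0<δ , δ≤1 , δ≤δ′)       = small 0<δ′
            (n₃ , μ-close)               = cauchy μ δ 0<δ
            -- Tolerance `½ δ` instead of `δ` makes `μₙ + δ` strictly positive.
            (n₄ , 0≤μ+½δ)                = 0≤μ (½ * δ) (half-pos δ 0<δ)
            (n₅ , sum≤η)                 = mean≤0 η 0<η
            (n₆ , 0≤sum+η)               = 0≤mean η 0<η
            n₀ = n₁ ℕ.⊔ n₂ ℕ.⊔ (n₃ ℕ.⊔ n₄) ℕ.⊔ (n₅ ℕ.⊔ n₆)
        in n₀ , λ n n₀≤n →
          let n₁₂₃₄ = ℕₚ.m⊔n≤o⇒m≤o (n₁ ℕ.⊔ n₂ ℕ.⊔ (n₃ ℕ.⊔ n₄)) (n₅ ℕ.⊔ n₆) n₀≤n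
              n₅₆ = ℕₚ.m⊔n≤o⇒n≤o (n₁ ℕ.⊔ n₂ ℕ.⊔ (n₃ ℕ.⊔ n₄)) (n₅ ℕ.⊔ n₆) n₀≤n
              n₁₂ = ℕₚ.m⊔n≤o⇒m≤o (n₁ ℕ.⊔ n₂) (n₃ ℕ.⊔ n₄) n₁₂₃₄
              n₃₄ = ℕₚ.m⊔n≤o⇒n≤o (n₁ ℕ.⊔ n₂) (n₃ ℕ.⊔ n₄) n₁₂₃₄
          in stage n 0<δ δ≤1 (half<self 0<δ) η≤1 η≤½ε
               (ℚₚ.<⇒≤ 0<R)
               (ℚₚ.≤-trans (*-monoʳ (R * K) (0≤* (ℚₚ.<⇒≤ 0<R) (ℚₚ.<⇒≤ 0<K)) δ≤δ′) (ℚₚ.≤-reflexive RKδ′≡½ε))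
               (ℚₚ.<⇒≤ (μ<B n (ℕₚ.m⊔n≤o⇒m≤o n₁ n₂ n₁₂)))
               refl
               (ℚₚ.<⇒≤ (‖α‖²<K n (ℕₚ.m⊔n≤o⇒n≤o n₁ n₂ n₁₂)))
               (n₃ , λ m n₃≤m → μ-close m n n₃≤m (ℕₚ.m⊔n≤o⇒m≤o n₃ n₄ n₃₄))
               (0≤μ+½δ n (ℕₚ.m⊔n≤o⇒n≤o n₃ n₄ n₃₄))
               (sum≤η n (ℕₚ.m⊔n≤o⇒m≤o n₅ n₆ n₅₆))
               (0≤sum+η n (ℕₚ.m⊔n≤o⇒n≤o n₅ n₆ n₅₆))
        where
        half<self : ∀ {δ} → 0ℚ < δ → ½ * δ < δ
        half<self {δ} 0<δ = subst (½ * δ <_) (halves δ)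
          (subst (_< ½ * δ + ½ * δ) (ℚₚ.+-identityʳ (½ * δ)) (ℚₚ.+-monoʳ-< (½ * δ) (half-pos δ 0<δ)))
        stage : ∀ n {δ η B K R} → 0ℚ < δ → δ ≤ 1ℚ → ½ * δ < δ → η ≤ 1ℚ → η ≤ ½ * ε →
          0ℚ ≤ R → R * K * δ ≤ ½ * ε →
          ∣ seq μ n ∣ ≤ B → R ≡ slopeBound (B + 1ℚ) → ∣ seq ‖ α ‖² n ∣ ≤ K →
          (∃ λ n₃ → ∀ m → n₃ ℕ.≤ m → ∣ seq μ m - seq μ n ∣ < δ) →
          0ℚ ≤ seq μ n + ½ * δ →
          seq ⟨ α , 𝟙 ⟩ n ≤ 0ℚ + η → 0ℚ ≤ seq ⟨ α , 𝟙 ⟩ n + η →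
          seq ‖ adjacency G · α ‖² n ≤ φ (seq μ n) * φ (seq μ n) * seq ‖ α ‖² n + ε
        stage n {δ} {η} {B} {K} {R} 0<δ δ≤1 ½δ<δ η≤1 η≤½ε 0≤R RKδ≤½ε x≤B R≡ S≤K (n₃ , close) 0≤x+½δ sum≤η 0≤sum+η =
          begin
            seq ‖ adjacency G · α ‖² n
              ≡⟨ seq-adjacency G α n ⟩
            sum (λ u → walk G f u * walk G f u)
              ≤⟨ expansion-sum G (G-expands q 0<q (n₃ , below)) f ⟩
            φ q * φ q * sum (λ v → f v * f v) + sum f * sum f
              ≡⟨ cong₂ (λ y z → φ q * φ q * y + z * z) (seq-norm α n) (seq-mean α n) ⟨
            φ q * φ q * S + s * s
              ≡⟨ cong (λ z → z * S + s * s) (φ²-increment δ x) ⟩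
            (φ x * φ x + δ * slope δ x) * S + s * s
              ≡⟨ expand (φ x * φ x) δ (slope δ x) S (s * s) ⟩
            φ x * φ x * S + (δ * (slope δ x * S) + s * s)
              ≤⟨ ℚₚ.+-monoʳ-≤ (φ x * φ x * S) (ℚₚ.+-mono-≤ slope-part mean-part) ⟩
            φ x * φ x * S + (½ * ε + ½ * ε)
              ≡⟨ cong (λ z → φ x * φ x * S + z) (halves ε) ⟩
            φ x * φ x * S + ε ∎
          where
          open ℚₚ.≤-Reasoning
          f : Fin N → ℚ
          f v = seq (α v) n
          x q S s : ℚ
          x = seq μ n
          q = x + δ
          S = seq ‖ α ‖² n
          s = seq ⟨ α , 𝟙 ⟩ n
          expand : ∀ a δ r S t → (a + δ * r) * S + t ≡ a * S + (δ * (r * S) + t)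
          expand = solve-∀ ℚ-ring
          0≤S : 0ℚ ≤ S
          0≤S = subst (0ℚ ≤_) (sym (seq-norm α n))
            (0≤sum λ v → 0≤square (f v))
          0<q : 0ℚ < q
          0<q = ℚₚ.≤-<-trans 0≤x+½δ (ℚₚ.+-monoʳ-< x ½δ<δ)
          below : ∀ m → n₃ ℕ.≤ m → seq μ m ≤ q
          below m n₃≤m = subst (_≤ q) (add-back x (seq μ m))
            (ℚₚ.+-monoʳ-≤ x (ℚₚ.≤-trans (p≤∣p∣ (seq μ m - x)) (ℚₚ.<⇒≤ (close m n₃≤m))))
            where
            add-back : ∀ x y → x + (y - x) ≡ y
            add-back = solve-∀ ℚ-ring
          ∣δ∣≤1 : ∣ δ ∣ ≤ 1ℚ
          ∣δ∣≤1 = ℚₚ.≤-trans (ℚₚ.≤-reflexive (ℚₚ.0≤p⇒∣p∣≡p (ℚₚ.<⇒≤ 0<δ))) δ≤1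
          slope≤R : slope δ x ≤ R
          slope≤R = subst (slope δ x ≤_) (sym R≡)
            (slope≤ (ℚₚ.≤-trans x≤B (≤-of-diff 1ℚ (ℚₚ.nonNegative⁻¹ 1ℚ) refl)) (∣∣-+ {x} x≤B ∣δ∣≤1))
          slope-part : δ * (slope δ x * S) ≤ ½ * ε
          slope-part = begin
            δ * (slope δ x * S)  ≤⟨ *-monoʳ δ (ℚₚ.<⇒≤ 0<δ) (*-monoˡ S 0≤S slope≤R) ⟩
            δ * (R * S)          ≤⟨ *-monoʳ δ (ℚₚ.<⇒≤ 0<δ) (*-monoʳ R 0≤R (ℚₚ.≤-trans (p≤∣p∣ S) S≤K)) ⟩
            δ * (R * K)          ≡⟨ ℚₚ.*-comm δ (R * K) ⟩
            R * K * δ            ≤⟨ RKδ≤½ε ⟩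
            ½ * ε                ∎
          0≤η : 0ℚ ≤ η
          0≤η = ℚₚ.≮⇒≥ λ η<0 → ℚₚ.<-irrefl refl (begin-strict
            0ℚ              ≤⟨ 0≤sum+η ⟩
            s + η           ≤⟨ ℚₚ.+-monoˡ-≤ η sum≤η ⟩
            0ℚ + η + η      <⟨ ℚₚ.+-mono-< (subst (_< 0ℚ) (sym (ℚₚ.+-identityˡ η)) η<0) η<0 ⟩
            0ℚ              ∎)
          mean-part : s * s ≤ ½ * ε
          mean-part = begin
            s * s      ≤⟨ square≤ {s} {η} 0≤sum+η (subst (s ≤_) (ℚₚ.+-identityˡ η) sum≤η) ⟩
            η * η      ≤⟨ *-monoʳ η 0≤η η≤1 ⟩
            η * 1ℚ     ≡⟨ ℚₚ.*-identityʳ η ⟩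
            η          ≤⟨ η≤½ε ⟩
            ½ * ε      ∎

  family-IsExpander : ∀ {D} .{{_ : NonZero D}} {H : Graph (Fin (D ^ 8)) (Fin D)} {μ} →
    IsExpander H μ → (t : ℕ) .{{_ : NonZero t}} →
    IsExpander {{ℕₚ.m^n≢0 D 2}} (family H t) (μ Defs.+ fromℚ (5ℚ * 5ℚ) Defs.* (μ Defs.* μ))
  family-IsExpander {D} {H} {μ} H-μ t =
    IsExpander-of-expansion {{ℕₚ.m^n≢0 D (8 ℕ.* t)}} {{ℕₚ.m^n≢0 D 2}} (family H t)
      (ℚₚ.nonNegative⁻¹ (5ℚ * 5ℚ)) μ (proj₁ H-μ)
      λ q 0<q μ≤q → family-expansion 0<q
        (expansion-of-IsExpander {{ℕₚ.m^n≢0 D 8}} H {μ = μ} 0<q μ≤q H-μ) t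

-- The program and the cost of its elementary procedures.

module Machine where

  open import Data.Nat.Base using (_+_; _*_; _∸_; _≤_; _<_)

  pattern divmodᶠ = 0F
  pattern encodeᶠ = 1F
  pattern powᶠ    = 2F
  pattern squareᶠ = 3F
  pattern tensorᶠ = 4F
  pattern stepᶠ   = 5F
  pattern zigzagᶠ = 6F
  pattern rotᶠ    = 7F

  signature : Fin 8 → ℕ × ℕ
  signature divmodᶠ = 2 , 2
  signature encodeᶠ = 3 , 1
  signature powᶠ    = 2 , 1
  signature squareᶠ = 3 , 2
  signature tensorᶠ = 3 , 2
  signature stepᶠ   = 6 , 3
  signature zigzagᶠ = 5 , 2
  signature rotᶠ    = 4 , 2

  infixr 1 _▸_

  _▸_ : ∀ {n k m} → Code signature n k → Code signature (k + n) m → Code signature n m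
  _▸_ = bind

  -- The comments list the variables in scope, starting with number 0.
  procedure : (f : Fin 8) → Code signature (proj₁ (signature f)) (proj₂ (signature f))
  procedure divmodᶠ =                                       -- x n
    arith div (# 0) (# 1) ▸                                 -- q x n
    arith mul (# 0) (# 2) ▸                                 -- qn q x n
    arith sub (# 2) (# 0) ▸                                 -- r qn q x n
    ret (# 2 ∷ # 0 ∷ [])
  procedure encodeᶠ =                                       -- i n j
    arith mul (# 1) (# 0) ▸                                 -- ni i n j
    arith add (# 0) (# 3)
  procedure powᶠ =                                          -- d k
    ifz (# 1) (const 1)
      (const 1 ▸                                            -- 1 d k
       arith sub (# 2) (# 0) ▸                              -- k-1 1 d k
       call powᶠ (# 2 ∷ # 0 ∷ []) ▸                         -- dᵏ⁻¹ k-1 1 d k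
       arith mul (# 3) (# 0))
  procedure squareᶠ =                                       -- d x ℓ
    call divmodᶠ (# 2 ∷ # 0 ∷ []) ▸                         -- k₁ k₂ d x ℓ
    query (# 3) (# 0) ▸                                     -- v₁ ℓ₁ k₁ k₂ d x ℓ
    query (# 0) (# 3) ▸                                     -- v₂ ℓ₂ v₁ ℓ₁ k₁ k₂ d x ℓ
    call encodeᶠ (# 1 ∷ # 6 ∷ # 3 ∷ []) ▸                   -- ℓ′ v₂ ℓ₂ …
    ret (# 1 ∷ # 0 ∷ [])
  procedure tensorᶠ =                                       -- d x ℓ
    const 8 ▸
    call powᶠ (# 1 ∷ # 0 ∷ []) ▸                            -- d⁸ 8 d x ℓ
    call divmodᶠ (# 3 ∷ # 0 ∷ []) ▸                         -- v w d⁸ 8 d x ℓ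
    call divmodᶠ (# 6 ∷ # 4 ∷ []) ▸                         -- i j v w d⁸ 8 d x ℓ
    query (# 2) (# 0) ▸                                     -- v′ i′ i j v w d⁸ 8 d x ℓ
    query (# 5) (# 3) ▸                                     -- w′ j′ v′ i′ i j v w d⁸ 8 d x ℓ
    call encodeᶠ (# 2 ∷ # 8 ∷ # 0 ∷ []) ▸                   -- x′ w′ j′ v′ i′ i j v w d⁸ 8 d x ℓ
    call encodeᶠ (# 4 ∷ # 11 ∷ # 2 ∷ []) ▸                  -- ℓ′ x′ …
    ret (# 1 ∷ # 0 ∷ [])
  -- A step in Gₐ ⊗ G_b, on separate vertices but a joint label.
  procedure stepᶠ =                                         -- a b d v w e
    arith mul (# 2) (# 2) ▸                                 -- d² a b d v w e
    call divmodᶠ (# 6 ∷ # 0 ∷ []) ▸                         -- e₁ e₂ d² a b d v w e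
    call rotᶠ (# 3 ∷ # 5 ∷ # 6 ∷ # 0 ∷ []) ▸                -- v′ e₁′ e₁ e₂ d² a b d v w e
    call rotᶠ (# 6 ∷ # 7 ∷ # 9 ∷ # 3 ∷ []) ▸                -- w′ e₂′ v′ e₁′ e₁ e₂ d² a b d v w e
    call encodeᶠ (# 3 ∷ # 6 ∷ # 1 ∷ []) ▸                   -- e′ w′ e₂′ v′ …
    ret (# 3 ∷ # 1 ∷ # 0 ∷ [])
  procedure zigzagᶠ =                                       -- a b d x ℓ
    const 8 ▸
    call powᶠ (# 3 ∷ # 0 ∷ []) ▸                            -- d⁸ 8 a b d x ℓ
    call divmodᶠ (# 5 ∷ # 0 ∷ []) ▸                         -- y k d⁸ 8 a b d x ℓ
    call divmodᶠ (# 8 ∷ # 6 ∷ []) ▸                         -- i j y k d⁸ 8 a b d x ℓ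
    query (# 3) (# 0) ▸                                     -- k′ i′ i j y k d⁸ 8 a b d x ℓ
    arith mul (# 7) (# 9) ▸                                 -- 8b k′ i′ i j y k d⁸ 8 a b d x ℓ
    call powᶠ (# 11 ∷ # 0 ∷ []) ▸                           -- n 8b k′ i′ i j y k d⁸ 8 a b d x ℓ
    call divmodᶠ (# 6 ∷ # 0 ∷ []) ▸                         -- v w n 8b k′ i′ i j y k d⁸ 8 a b d x ℓ
    const 4 ▸
    call powᶠ (# 15 ∷ # 0 ∷ []) ▸                           -- d⁴ 4 v w n 8b k′ …
    call divmodᶠ (# 6 ∷ # 0 ∷ []) ▸                         -- e f d⁴ 4 v w n 8b k′ …
    call stepᶠ (# 16 ∷ # 17 ∷ # 18 ∷ # 4 ∷ # 5 ∷ # 0 ∷ []) ▸ -- v₁ w₁ e′ e f d⁴ …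
    call stepᶠ (# 19 ∷ # 20 ∷ # 21 ∷ # 0 ∷ # 1 ∷ # 4 ∷ []) ▸ -- v₂ w₂ f′ v₁ w₁ e′ e f d⁴ …
    -- A square returns its labels in reverse order, so `f′` precedes `e′`; for the same reason `j′`
    -- precedes `i′` in the final label.
    call encodeᶠ (# 2 ∷ # 8 ∷ # 5 ∷ []) ▸                   -- ℓ₂ v₂ w₂ f′ …
    query (# 0) (# 18) ▸                                    -- l j′ ℓ₂ v₂ w₂ f′ …
    call encodeᶠ (# 3 ∷ # 15 ∷ # 4 ∷ []) ▸                  -- y′ l j′ …
    call encodeᶠ (# 0 ∷ # 24 ∷ # 1 ∷ []) ▸                  -- x′ y′ l j′ …
    call encodeᶠ (# 3 ∷ # 29 ∷ # 20 ∷ []) ▸                 -- ℓ′ x′ …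
    ret (# 1 ∷ # 0 ∷ [])
  procedure rotᶠ =                                          -- t d x ℓ
    const 1 ▸
    arith sub (# 1) (# 0) ▸                                 -- t-1 1 t d x ℓ
    ifz (# 0) (call squareᶠ (# 3 ∷ # 4 ∷ # 5 ∷ []))
      (arith sub (# 0) (# 1) ▸                              -- t-2 t-1 1 t d x ℓ
       ifz (# 0) (call tensorᶠ (# 4 ∷ # 5 ∷ # 6 ∷ []))
         (const 2 ▸                                         -- 2 t-2 t-1 1 t d x ℓ
          arith div (# 2) (# 0) ▸                           -- b 2 t-2 t-1 1 t d x ℓ
          arith sub (# 3) (# 0) ▸                           -- a b 2 t-2 t-1 1 t d x ℓ
          call zigzagᶠ (# 0 ∷ # 1 ∷ # 7 ∷ # 8 ∷ # 9 ∷ [])))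

  program : Program 4 2
  program = record
    { procedures = 8
    ; sig        = signature
    ; body       = procedure
    ; main       = call rotᶠ (# 0 ∷ # 1 ∷ # 2 ∷ # 3 ∷ [])
    }

  -- B bounds all numbers that occur, so that every operation costs at most
  -- s = size B per argument; n counts such units of time.
  module Cost {N D : ℕ} (H : Graph (Fin N) (Fin D)) {B : ℕ} (N≤B : N ≤ B) (D≤B : D ≤ B) where

    s : ℕ
    s = size B

    -- A Hoare triple with resources. The bound `B` is assumed of the environment and returned for
    -- the results, so triples compose along `bind`; exact times are hidden behind upper bounds.
    record Costs {k} (ρ : Vec ℕ k) {m} (c : Code signature k m) (ys : Vec ℕ m) (n q : ℕ) : Set where
      field
        evaluate : All (_≤ B) ρ →
          Σ[ T ∈ ℕ ] Σ[ Q ∈ ℕ ] Eval program H ρ c ys T Q × T ≤ n * s × Q ≤ q × All (_≤ B) ys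

    open Costs public

    size≤s : ∀ {x} → x ≤ B → size x ≤ s
    size≤s x≤B = s≤s (⌊log₂⌋-mono-≤ x≤B)

    sizes≤ : ∀ {k} {xs : Vec ℕ k} → All (_≤ B) xs → sizes xs ≤ k * s
    sizes≤ []           = z≤n
    sizes≤ (x≤B ∷ xs≤B) = ℕₚ.+-mono-≤ (size≤s x≤B) (sizes≤ xs≤B)

    1≤s : 1 ≤ s
    1≤s = s≤s z≤n

    toℕ≤B : ∀ {k} → k ≤ B → (i : Fin k) → toℕ i ≤ B
    toℕ≤B k≤B i = ℕₚ.≤-trans (ℕₚ.<⇒≤ (Finₚ.toℕ<n i)) k≤B

    module _ {k : ℕ} {ρ : Vec ℕ k} where

      lookups : ∀ {m} (xs : Vec (Fin k) m) → All (_≤ B) ρ → All (_≤ B) (Vec.map (lookup ρ) xs)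
      lookups []       ρ≤B = []
      lookups (x ∷ xs) ρ≤B = Allₚ.lookup⁺ ρ≤B x ∷ lookups xs ρ≤B

      ret-costs : ∀ {m} (xs : Vec (Fin k) m) → Costs ρ (ret xs) (Vec.map (lookup ρ) xs) (1 + m) 0
      evaluate (ret-costs xs) ρ≤B =
        _ , _ , ret xs , ℕₚ.+-mono-≤ 1≤s (sizes≤ (lookups xs ρ≤B)) , z≤n , lookups xs ρ≤B

      const-costs : ∀ c → c ≤ B → Costs ρ (const c) (c ∷ []) 1 0
      evaluate (const-costs c c≤B) ρ≤B =
        _ , _ , const c , ℕₚ.≤-trans (size≤s c≤B) (ℕₚ.m≤m+n s 0) , z≤n , c≤B ∷ []

      arith-costs : ∀ {o x y z} → apply o (lookup ρ x) (lookup ρ y) ≡ z → z ≤ B →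
        Costs ρ (arith o x y) (z ∷ []) 2 0
      evaluate (arith-costs {o} {x} {y} refl z≤B) ρ≤B =
        _ , _ , arith o x y ,
        ℕₚ.+-mono-≤ (size≤s (Allₚ.lookup⁺ ρ≤B x))
          (ℕₚ.≤-trans (size≤s (Allₚ.lookup⁺ ρ≤B y)) (ℕₚ.m≤m+n s 0)) ,
        z≤n , z≤B ∷ []

      query-costs : ∀ {x y} v i → lookup ρ x ≡ toℕ v → lookup ρ y ≡ toℕ i →
        Costs ρ (query x y) (toℕ (proj₁ (rot H (v , i))) ∷ toℕ (proj₂ (rot H (v , i))) ∷ []) 1 1
      evaluate (query-costs v i x≡v y≡i) ρ≤B =
        _ , _ , query v i x≡v y≡i , ℕₚ.≤-trans 1≤s (ℕₚ.m≤m+n s 0) , ℕₚ.≤-refl ,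
        toℕ≤B N≤B _ ∷ toℕ≤B D≤B _ ∷ []

      call-costs : ∀ {f xs ys n q} → Costs (Vec.map (lookup ρ) xs) (procedure f) ys n q →
        Costs ρ (call f xs) ys (1 + (proj₁ (signature f) + n)) q
      evaluate (call-costs {f} {xs} {n = n} f-costs) ρ≤B =
        let (_ , _ , e , T≤ , Q≤ , ys≤B) = evaluate f-costs (lookups xs ρ≤B)
        in _ , _ , call e ,
           ℕₚ.+-mono-≤ 1≤s (ℕₚ.≤-trans (ℕₚ.+-mono-≤ (sizes≤ (lookups xs ρ≤B)) T≤)
             (ℕₚ.≤-reflexive (sym (ℕₚ.*-distribʳ-+ s (proj₁ (signature f)) n)))) ,
           Q≤ , ys≤B

      infixr 1 _▹_

      _▹_ : ∀ {l m} {c : Code signature k l} {d : Code signature (l + k) m} {ys zs n n′ q q′} →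
        Costs ρ c ys n q → Costs (ys Vec.++ ρ) d zs n′ q′ → Costs ρ (bind c d) zs (n + n′) (q + q′)
      evaluate (_▹_ {n = n} {n′} c-costs d-costs) ρ≤B =
        let (_ , _ , e₁ , T₁≤ , Q₁≤ , ys≤B) = evaluate c-costs ρ≤B
            (_ , _ , e₂ , T₂≤ , Q₂≤ , zs≤B) = evaluate d-costs (Allₚ.++⁺ ys≤B ρ≤B)
        in _ , _ , bind e₁ e₂ ,
           ℕₚ.≤-trans (ℕₚ.+-mono-≤ T₁≤ T₂≤) (ℕₚ.≤-reflexive (sym (ℕₚ.*-distribʳ-+ s n n′))) ,
           ℕₚ.+-mono-≤ Q₁≤ Q₂≤ , zs≤B

      ifz-0-costs : ∀ {x m} {c d : Code signature k m} {ys n q} → lookup ρ x ≡ 0 →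
        Costs ρ c ys n q → Costs ρ (ifz x c d) ys (1 + n) q
      evaluate (ifz-0-costs {x} x≡0 c-costs) ρ≤B =
        let (_ , _ , e , T≤ , Q≤ , ys≤B) = evaluate c-costs ρ≤B
        in _ , _ , ifz-0 x≡0 e , ℕₚ.+-mono-≤ (size≤s (Allₚ.lookup⁺ ρ≤B x)) T≤ , Q≤ , ys≤B

      ifz-s-costs : ∀ {x m} {c d : Code signature k m} {ys n q} → NonZero (lookup ρ x) →
        Costs ρ d ys n q → Costs ρ (ifz x c d) ys (1 + n) q
      evaluate (ifz-s-costs {x} x≢0 d-costs) ρ≤B =
        let (_ , _ , e , T≤ , Q≤ , ys≤B) = evaluate d-costs ρ≤B
        in _ , _ , ifz-s x≢0 e , ℕₚ.+-mono-≤ (size≤s (Allₚ.lookup⁺ ρ≤B x)) T≤ , Q≤ , ys≤B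

      weaken : ∀ {m} {c : Code signature k m} {ys n n′ q q′} → n ≤ n′ → q ≤ q′ →
        Costs ρ c ys n q → Costs ρ c ys n′ q′
      evaluate (weaken n≤n′ q≤q′ c-costs) ρ≤B =
        let (_ , _ , e , T≤ , Q≤ , ys≤B) = evaluate c-costs ρ≤B
        in _ , _ , e , ℕₚ.≤-trans T≤ (ℕₚ.*-monoˡ-≤ s n≤n′) , ℕₚ.≤-trans Q≤ q≤q′ , ys≤B

    [n*i+j]/n≡i : ∀ n .{{_ : NonZero n}} i {j} → j < n → (n * i + j) / n ≡ i
    [n*i+j]/n≡i n i {j} j<n = begin
      (n * i + j) / n      ≡⟨ +-distrib-/-∣ˡ j (divides i (ℕₚ.*-comm n i)) ⟩
      n * i / n + j / n    ≡⟨ cong₂ _+_ (trans (cong (_/ n) (ℕₚ.*-comm n i)) (m*n/n≡m i n)) (m<n⇒m/n≡0 j<n) ⟩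
      i + 0                ≡⟨ ℕₚ.+-identityʳ i ⟩
      i                    ∎
      where open ≡-Reasoning

    div-costs : ∀ {k} {ρ : Vec ℕ k} {x y n i j} → lookup ρ x ≡ n * i + j → lookup ρ y ≡ n → j < n → i ≤ B →
      Costs ρ (arith div x y) (i ∷ []) 2 0
    div-costs {n = suc n} {i} x≡ y≡ j<n i≤B = arith-costs
      (trans (cong₂ (apply div) x≡ y≡) ([n*i+j]/n≡i (suc n) i j<n)) i≤B

    divmod-costs : ∀ {x n i j} → x ≡ n * i + j → j < n → x ≤ B →
      Costs (x ∷ n ∷ []) (procedure divmodᶠ) (i ∷ j ∷ []) 9 0
    divmod-costs {x} {n@(suc _)} {i} {j} x≡ni+j j<n x≤B =
      div-costs x≡ni+j refl j<n (ℕₚ.≤-trans (ℕₚ.≤-trans (ℕₚ.m≤n*m i n) ni≤x) x≤B) ▹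
      arith-costs (ℕₚ.*-comm i n) (ℕₚ.≤-trans ni≤x x≤B) ▹
      arith-costs (trans (cong (_∸ n * i) x≡ni+j) (ℕₚ.m+n∸m≡n (n * i) j))
        (ℕₚ.≤-trans (subst (j ≤_) (sym x≡ni+j) (ℕₚ.m≤n+m j (n * i))) x≤B) ▹
      ret-costs (# 2 ∷ # 0 ∷ [])
      where
      ni≤x : n * i ≤ x
      ni≤x = subst (n * i ≤_) (sym x≡ni+j) (ℕₚ.m≤m+n (n * i) j)

    module _ {m n k : ℕ} .(eq : m * n ≡ k) where

      open Inverse (pairs {m} {n} eq) using (to; from; strictlyInverseˡ)

      toℕ-to : ∀ i j → toℕ (to (i , j)) ≡ n * toℕ i + toℕ j
      toℕ-to i j = trans (Finₚ.toℕ-cast eq (combine i j)) (Finₚ.toℕ-combine i j)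

      toℕ-from : ∀ x → toℕ x ≡ n * toℕ (proj₁ (from x)) + toℕ (proj₂ (from x))
      toℕ-from x = trans (cong toℕ (sym (strictlyInverseˡ x))) (toℕ-to (proj₁ (from x)) (proj₂ (from x)))

      decode-costs : k ≤ B → ∀ x →
        Costs (toℕ x ∷ n ∷ []) (procedure divmodᶠ) (toℕ (proj₁ (from x)) ∷ toℕ (proj₂ (from x)) ∷ []) 9 0
      decode-costs k≤B x = divmod-costs (toℕ-from x) (Finₚ.toℕ<n (proj₂ (from x))) (toℕ≤B k≤B x)

      encode-costs : k ≤ B → ∀ i j →
        Costs (toℕ i ∷ n ∷ toℕ j ∷ []) (procedure encodeᶠ) (toℕ (to (i , j)) ∷ []) 4 0
      encode-costs k≤B i j =
        arith-costs refl (ℕₚ.m+n≤o⇒m≤o (n * toℕ i) (subst (_≤ B) (toℕ-to i j) to≤B)) ▹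
        arith-costs (sym (toℕ-to i j)) to≤B
        where
        to≤B : toℕ (to (i , j)) ≤ B
        to≤B = toℕ≤B k≤B (to (i , j))

    pow-costs : ∀ d .{{_ : NonZero d}} k → k ≤ B → d ^ k ≤ B → 1 ≤ B →
      Costs (d ∷ k ∷ []) (procedure powᶠ) (d ^ k ∷ []) (2 + 9 * k) 0
    pow-costs d zero    k≤B dᵏ≤B 1≤B = ifz-0-costs refl (const-costs 1 1≤B)
    pow-costs d (suc k) k≤B dᵏ≤B 1≤B = weaken (ℕₚ.≤-reflexive (count k)) z≤n (ifz-s-costs _
      (const-costs 1 1≤B ▹
       arith-costs refl k′≤B ▹
       call-costs (pow-costs d k k′≤B
         (ℕₚ.≤-trans (ℕₚ.m≤n*m (d ^ k) d) dᵏ≤B) 1≤B) ▹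
       arith-costs refl dᵏ≤B))
      where
      k′≤B : k ≤ B
      k′≤B = ℕₚ.≤-trans (ℕₚ.n≤1+n k) k≤B
      count : ∀ k → 1 + (1 + (2 + (1 + (2 + (2 + 9 * k)) + 2))) ≡ 2 + 9 * suc k
      count = solve-ℕ

-- Correctness and cost of the recursive evaluation.

module RotationCost where

  open import Data.Nat.Base using (_+_; _*_; _∸_; _≤_; _<_)
  open Machine

  module Rotations {D : ℕ} .{{_ : NonZero D}} (H : Graph (Fin (D ^ 8)) (Fin D))
    {t₀ : ℕ} (1≤t₀ : 1 ≤ t₀) {B : ℕ} (8t₀≤B : 8 * t₀ ≤ B) (D^8t₀≤B : D ^ (8 * t₀) ≤ B) where

    private
      ≤8t₀⇒≤B : ∀ {k} → k ≤ 8 * t₀ → k ≤ B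
      ≤8t₀⇒≤B k≤ = ℕₚ.≤-trans k≤ 8t₀≤B

      ^≤B : ∀ {k} → k ≤ 8 * t₀ → D ^ k ≤ B
      ^≤B k≤ = ℕₚ.≤-trans (ℕₚ.^-monoʳ-≤ D k≤) D^8t₀≤B

      ≤8⇒≤8t₀ : ∀ {k} → k ≤ 8 → k ≤ 8 * t₀
      ≤8⇒≤8t₀ k≤8 = ℕₚ.≤-trans k≤8 (ℕₚ.m≤m*n 8 t₀ {{ℕ.>-nonZero 1≤t₀}})

      8≤ : 8 ≤ 8 * t₀
      8≤ = ≤8⇒≤8t₀ ℕₚ.≤-refl
      4≤ : 4 ≤ 8 * t₀
      4≤ = ≤8⇒≤8t₀ (ℕₚ.≤ᵇ⇒≤ 4 8 _)
      2≤ : 2 ≤ 8 * t₀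
      2≤ = ≤8⇒≤8t₀ (ℕₚ.≤ᵇ⇒≤ 2 8 _)
      1≤ : 1 ≤ 8 * t₀
      1≤ = ≤8⇒≤8t₀ (ℕₚ.≤ᵇ⇒≤ 1 8 _)

      D≤B : D ≤ B
      D≤B = subst (_≤ B) (ℕₚ.*-identityʳ D) (^≤B 1≤)

      L↔ : (Fin D × Fin D) ↔ Fin (D ^ 2)
      L↔ = pairs (D*D≡D² D)

    open Cost H (^≤B 8≤) D≤B public

    Computes : ∀ {V E k} → Vec ℕ k → Code signature k 2 → Graph (Fin V) (Fin E) → Fin V → Fin E → ℕ → ℕ → Set
    Computes ρ c G v ℓ n q =
      Costs ρ c (toℕ (proj₁ (rot G (v , ℓ))) ∷ toℕ (proj₂ (rot G (v , ℓ))) ∷ []) n q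

    power-costs : ∀ k → k ≤ 8 * t₀ → Costs (D ∷ k ∷ []) (procedure powᶠ) (D ^ k ∷ []) (2 + 9 * k) 0
    power-costs k k≤ = pow-costs D k (≤8t₀⇒≤B k≤) (^≤B k≤) (≤8t₀⇒≤B 1≤)

    square-costs : ∀ v ℓ →
      Computes (D ∷ toℕ v ∷ toℕ ℓ ∷ []) (procedure squareᶠ) (squareOf (D*D≡D² D) H) v ℓ 25 2
    square-costs v ℓ =
      call-costs (decode-costs {D} {D} (D*D≡D² D) (^≤B 2≤) ℓ) ▹
      query-costs v k₁ refl refl ▹
      query-costs v₁ k₂ refl refl ▹
      call-costs (encode-costs {D} {D} (D*D≡D² D) (^≤B 2≤) ℓ₂ ℓ₁) ▹
      ret-costs (# 1 ∷ # 0 ∷ [])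
      where
      k₁ k₂ ℓ₁ ℓ₂ : Fin D
      k₁ = proj₁ (Inverse.from L↔ ℓ)
      k₂ = proj₂ (Inverse.from L↔ ℓ)
      v₁ : Fin (D ^ 8)
      v₁ = proj₁ (rot H (v , k₁))
      ℓ₁ = proj₂ (rot H (v , k₁))
      ℓ₂ = proj₂ (rot H (v₁ , k₂))

    tensor-costs : 16 ≤ 8 * t₀ → ∀ v ℓ →
      Computes (D ∷ toℕ v ∷ toℕ ℓ ∷ []) (procedure tensorᶠ) (tensorSquareOf (D*D≡D² D) (^-+ D 8 8) H) v ℓ 123 2
    tensor-costs 16≤ x ℓ =
      const-costs 8 (≤8t₀⇒≤B 8≤) ▹
      call-costs (power-costs 8 8≤) ▹
      call-costs (decode-costs {D ^ 8} {D ^ 8} (^-+ D 8 8) (^≤B 16≤) x) ▹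
      call-costs (decode-costs {D} {D} (D*D≡D² D) (^≤B 2≤) ℓ) ▹
      query-costs v i refl refl ▹
      query-costs w j refl refl ▹
      call-costs (encode-costs {D ^ 8} {D ^ 8} (^-+ D 8 8) (^≤B 16≤)
        (proj₁ (rot H (v , i))) (proj₁ (rot H (w , j)))) ▹
      call-costs (encode-costs {D} {D} (D*D≡D² D) (^≤B 2≤) (proj₂ (rot H (v , i))) (proj₂ (rot H (w , j)))) ▹
      ret-costs (# 1 ∷ # 0 ∷ [])
      where
      v w : Fin (D ^ 8)
      v = proj₁ (Inverse.from (pairs {D ^ 8} {D ^ 8} (^-+ D 8 8)) x)
      w = proj₂ (Inverse.from (pairs {D ^ 8} {D ^ 8} (^-+ D 8 8)) x)
      i j : Fin D
      i = proj₁ (Inverse.from L↔ ℓ)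
      j = proj₂ (Inverse.from L↔ ℓ)

    module _ {a b : ℕ} {Gₐ : Graph (Fin (D ^ (8 * a))) (Fin (D ^ 2))} {G_b : Graph (Fin (D ^ (8 * b))) (Fin (D ^ 2))}
      {nₐ n_b qₐ q_b : ℕ}
      (Gₐ-costs : ∀ v ℓ → Computes (a ∷ D ∷ toℕ v ∷ toℕ ℓ ∷ []) (procedure rotᶠ) Gₐ v ℓ nₐ qₐ)
      (G_b-costs : ∀ v ℓ → Computes (b ∷ D ∷ toℕ v ∷ toℕ ℓ ∷ []) (procedure rotᶠ) G_b v ℓ n_b q_b) where

      private
        E↔ : (Fin (D ^ 2) × Fin (D ^ 2)) ↔ Fin (D ^ 4)
        E↔ = pairs (^-+ D 2 2)

      step-costs : ∀ v w (e : Fin (D ^ 4)) →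
        let (e₁ , e₂) = Inverse.from E↔ e in
        Costs (a ∷ b ∷ D ∷ toℕ v ∷ toℕ w ∷ toℕ e ∷ []) (procedure stepᶠ)
          (toℕ (proj₁ (rot Gₐ (v , e₁))) ∷ toℕ (proj₁ (rot G_b (w , e₂))) ∷
           toℕ (Inverse.to E↔ (proj₂ (rot Gₐ (v , e₁)) , proj₂ (rot G_b (w , e₂)))) ∷ [])
          (36 + (nₐ + n_b)) (qₐ + q_b)
      step-costs v w e =
        weaken (ℕₚ.≤-reflexive (count nₐ n_b)) (ℕₚ.≤-reflexive (cong (λ z → qₐ + z) (ℕₚ.+-identityʳ q_b)))
          (arith-costs (D*D≡D² D) (^≤B 2≤) ▹
           call-costs (decode-costs {D ^ 2} {D ^ 2} (^-+ D 2 2) (^≤B 4≤) e) ▹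
           call-costs (Gₐ-costs v e₁) ▹
           call-costs (G_b-costs w e₂) ▹
           call-costs (encode-costs {D ^ 2} {D ^ 2} (^-+ D 2 2) (^≤B 4≤)
             (proj₂ (rot Gₐ (v , e₁))) (proj₂ (rot G_b (w , e₂)))) ▹
           ret-costs (# 3 ∷ # 1 ∷ # 0 ∷ []))
        where
        e₁ e₂ : Fin (D ^ 2)
        e₁ = proj₁ (Inverse.from E↔ e)
        e₂ = proj₂ (Inverse.from E↔ e)
        count : ∀ nₐ n_b → 2 + (12 + (5 + nₐ + (5 + n_b + (8 + 4)))) ≡ 36 + (nₐ + n_b)
        count = solve-ℕ

      zigzag-costs : ∀ {V} .(eqV : (D ^ (8 * a) * D ^ (8 * b)) * D ^ 8 ≡ V) → V ≤ B → D ^ (8 * a) * D ^ (8 * b) ≤ B →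
        8 * b ≤ 8 * t₀ → ∀ x ℓ →
        Computes (a ∷ b ∷ D ∷ toℕ x ∷ toℕ ℓ ∷ []) (procedure zigzagᶠ)
          (zigzagOf (D*D≡D² D) (^-+ D 2 2) (^-+ D 4 4) eqV Gₐ G_b H) x ℓ
          (298 + (72 * b + 2 * (nₐ + n_b))) (2 + 2 * (qₐ + q_b))
      zigzag-costs {V} eqV V≤B AB≤B 8b≤ x ℓ =
        weaken (ℕₚ.≤-reflexive (count b (nₐ + n_b))) (ℕₚ.≤-reflexive (query-count (qₐ + q_b)))
          (const-costs 8 (≤8t₀⇒≤B 8≤) ▹
           call-costs (power-costs 8 8≤) ▹
           call-costs (decode-costs {A * A′} {D ^ 8} eqV V≤B x) ▹
           call-costs (decode-costs {D} {D} (D*D≡D² D) (^≤B 2≤) ℓ) ▹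
           query-costs k i refl refl ▹
           arith-costs refl (≤8t₀⇒≤B 8b≤) ▹
           call-costs (power-costs (8 * b) 8b≤) ▹
           call-costs (decode-costs {A} {A′} refl AB≤B y) ▹
           const-costs 4 (≤8t₀⇒≤B 4≤) ▹
           call-costs (power-costs 4 4≤) ▹
           call-costs (decode-costs {D ^ 4} {D ^ 4} (^-+ D 4 4) (^≤B 8≤) k′) ▹
           call-costs (step-costs v w e) ▹
           call-costs (step-costs v₁ w₁ f) ▹
           call-costs (encode-costs {D ^ 4} {D ^ 4} (^-+ D 4 4) (^≤B 8≤) f′ e′) ▹
           query-costs ℓ₂ j refl refl ▹
           call-costs (encode-costs {A} {A′} refl AB≤B v₂ w₂) ▹
           call-costs (encode-costs {A * A′} {D ^ 8} eqV V≤B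
             (Inverse.to (pairs {A} {A′} refl) (v₂ , w₂)) (proj₁ (rot H (ℓ₂ , j)))) ▹
           call-costs (encode-costs {D} {D} (D*D≡D² D) (^≤B 2≤) (proj₂ (rot H (ℓ₂ , j))) (proj₂ (rot H (k , i)))) ▹
           ret-costs (# 1 ∷ # 0 ∷ []))
        where
        A A′ : ℕ
        A  = D ^ (8 * a)
        A′ = D ^ (8 * b)
        y : Fin (A * A′)
        y = proj₁ (Inverse.from (pairs {A * A′} {D ^ 8} eqV) x)
        k k′ ℓ₂ : Fin (D ^ 8)
        k = proj₂ (Inverse.from (pairs {A * A′} {D ^ 8} eqV) x)
        i j : Fin D
        i = proj₁ (Inverse.from L↔ ℓ)
        j = proj₂ (Inverse.from L↔ ℓ)
        k′ = proj₁ (rot H (k , i))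
        v v₁ v₂ : Fin A
        w w₁ w₂ : Fin A′
        v = proj₁ (Inverse.from (pairs {A} {A′} refl) y)
        w = proj₂ (Inverse.from (pairs {A} {A′} refl) y)
        e f e′ f′ : Fin (D ^ 4)
        e = proj₁ (Inverse.from (pairs {D ^ 4} {D ^ 4} (^-+ D 4 4)) k′)
        f = proj₂ (Inverse.from (pairs {D ^ 4} {D ^ 4} (^-+ D 4 4)) k′)
        e₁ e₂ f₁ f₂ : Fin (D ^ 2)
        e₁ = proj₁ (Inverse.from E↔ e)
        e₂ = proj₂ (Inverse.from E↔ e)
        f₁ = proj₁ (Inverse.from E↔ f)
        f₂ = proj₂ (Inverse.from E↔ f)
        v₁ = proj₁ (rot Gₐ (v , e₁))
        w₁ = proj₁ (rot G_b (w , e₂))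
        e′ = Inverse.to E↔ (proj₂ (rot Gₐ (v , e₁)) , proj₂ (rot G_b (w , e₂)))
        v₂ = proj₁ (rot Gₐ (v₁ , f₁))
        w₂ = proj₁ (rot G_b (w₁ , f₂))
        f′ = Inverse.to E↔ (proj₂ (rot Gₐ (v₁ , f₁)) , proj₂ (rot G_b (w₁ , f₂)))
        ℓ₂ = Inverse.to (pairs {D ^ 4} {D ^ 4} (^-+ D 4 4)) (f′ , e′)
        count : ∀ b n → 1 + (77 + (12 + (12 + (1 + (2 + (3 + (2 + 9 * (8 * b)) + (12 + (1 + (41 + (12 +
          (43 + n + (43 + n + (8 + (1 + (8 + (8 + (8 + 3))))))))))))))))) ≡ 298 + (72 * b + 2 * n)
        count = solve-ℕ
        query-count : ∀ q → 1 + (q + (q + 1)) ≡ 2 + 2 * q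
        query-count = solve-ℕ

    -- The cost of one call apart from its recursive calls: 18 for `rotᶠ`, 298 for `zigzagᶠ`, and 72
    -- b for computing `D ^ (8 * b)` by repeated multiplication. It is taken at the outermost
    -- argument `t₀`, so that it stays fixed along the recursion.
    unit : ℕ
    unit = 316 + 72 * t₀

    parity : ∀ n → Σ[ r ∈ ℕ ] r ≤ 1 × n ≡ 2 * ℕ.⌊ n /2⌋ + r
    parity zero          = 0 , z≤n , refl
    parity (suc zero)    = 1 , s≤s z≤n , refl
    parity (suc (suc n)) =
      let (r , r≤1 , n≡) = parity n
      in r , r≤1 , trans (cong (λ z → 2 + z) n≡) (shift ℕ.⌊ n /2⌋ r)
      where
      shift : ∀ b r → 2 + (2 * b + r) ≡ 2 * suc b + r
      shift = solve-ℕ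

    -- Both recurrences, n(t) ≤ unit + 2 (n(⌈(t-1)/2⌉) + n(⌊(t-1)/2⌋)) for the
    -- time and the one with 2 in place of unit for the queries, are solved by
    -- multiples of t².
    halves-squared : ∀ n → let a = ℕ.⌈ n /2⌉ ; b = ℕ.⌊ n /2⌋ in
      1 + 2 * (a * a + b * b) ≤ suc n * suc n
    halves-squared n with r , r≤1 , n≡ ← parity n =
      subst₂ (λ a m → 1 + 2 * (a * a + b * b) ≤ suc m * suc m) (sym a≡b+r) (sym n≡) (cases r≤1)
      where
      b : ℕ
      b = ℕ.⌊ n /2⌋
      a≡b+r : ℕ.⌈ n /2⌉ ≡ b + r
      a≡b+r = ℕₚ.+-cancelˡ-≡ b _ _ (trans (ℕₚ.⌊n/2⌋+⌈n/2⌉≡n n) (trans n≡ (regroup b r)))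
        where
        regroup : ∀ b r → 2 * b + r ≡ b + (b + r)
        regroup = solve-ℕ
      -- Since 2 (a² + b²) = (a + b)² + (a - b)² = n² + r², the slack is 2 n - r²: 4 b for even `n`
      -- and 4 b + 1 for odd `n`.
      cases : ∀ {r} → r ≤ 1 → 1 + 2 * ((b + r) * (b + r) + b * b) ≤ suc (2 * b + r) * suc (2 * b + r)
      cases z≤n = ℕₚ.m+n≤o⇒m≤o _ (ℕₚ.≤-reflexive (even b))
        where
        even : ∀ b → 1 + 2 * ((b + 0) * (b + 0) + b * b) + 4 * b ≡ suc (2 * b + 0) * suc (2 * b + 0)
        even = solve-ℕ
      cases (s≤s z≤n) = ℕₚ.m+n≤o⇒m≤o _ (ℕₚ.≤-reflexive (odd b))
        where
        odd : ∀ b → 1 + 2 * ((b + 1) * (b + 1) + b * b) + (1 + 4 * b) ≡ suc (2 * b + 1) * suc (2 * b + 1)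
        odd = solve-ℕ

    -- The recursion consumes the same accessibility proof as `familyAcc`, so each recursive call
    -- meets exactly the graph used there. It also establishes termination, as a derivation of
    -- `Eval` is a finite run.
    rotation-costs : ∀ t .{{_ : NonZero t}} (rs : Acc _<_ t) → t ≤ t₀ → ∀ v ℓ →
      Computes (t ∷ D ∷ toℕ v ∷ toℕ ℓ ∷ []) (procedure rotᶠ) (familyAcc H t rs) v ℓ (unit * (t * t)) (2 * (t * t))
    rotation-costs 1 _ t≤t₀ v ℓ =
      weaken (ℕₚ.≤-trans (ℕₚ.≤ᵇ⇒≤ 33 316 _) (ℕₚ.≤-trans (ℕₚ.m≤m+n 316 (72 * t₀)) (ℕₚ.m≤m*n unit 1))) ℕₚ.≤-refl
        (const-costs 1 (≤8t₀⇒≤B 1≤) ▹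
         arith-costs refl z≤n ▹
         ifz-0-costs refl (call-costs (square-costs v ℓ)))
    rotation-costs 2 _ t≤t₀ v ℓ =
      weaken (ℕₚ.≤-trans (ℕₚ.≤ᵇ⇒≤ 134 316 _) (ℕₚ.≤-trans (ℕₚ.m≤m+n 316 (72 * t₀)) (ℕₚ.m≤m*n unit 4)))
        (ℕₚ.≤ᵇ⇒≤ 2 8 _)
        (const-costs 1 (≤8t₀⇒≤B 1≤) ▹
         arith-costs refl (≤8t₀⇒≤B 1≤) ▹
         ifz-s-costs _
           (arith-costs refl z≤n ▹
            ifz-0-costs refl (call-costs (tensor-costs (ℕₚ.*-monoʳ-≤ 8 t≤t₀) v ℓ))))
    rotation-costs (suc (suc (suc s))) (acc rs) t≤t₀ v ℓ =
      weaken time queries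
        (const-costs 1 (≤8t₀⇒≤B 1≤) ▹
         arith-costs refl n≤B ▹
         ifz-s-costs _
           (arith-costs refl (ℕₚ.≤-trans (ℕₚ.n≤1+n (suc s)) n≤B) ▹
            ifz-s-costs _
              (const-costs 2 (≤8t₀⇒≤B 2≤) ▹
               -- `parity` writes `n` as `2 * b + r` with `r < 2`, which identifies the machine
               -- quotient with `b`.
               div-costs (proj₂ (proj₂ (parity n))) refl (s≤s (proj₁ (proj₂ (parity n)))) (ℕₚ.≤-trans b≤n n≤B) ▹
               arith-costs a≡n∸b (ℕₚ.≤-trans a≤n n≤B) ▹
               call-costs (zigzag-costs {Gₐ = familyAcc H a accₐ} {G_b = familyAcc H b acc_b}
                 (rotation-costs a (rs (ℕₚ.m<n⇒m<1+n (ℕₚ.⌈n/2⌉<n s))) (ℕₚ.≤-trans a≤n n≤t₀))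
                 (rotation-costs b (rs (ℕₚ.m<n⇒m<1+n (ℕₚ.⌊n/2⌋<n (suc s)))) b≤t₀)
                 (vertices-eq D (suc s)) V≤B
                 (ℕₚ.≤-trans (ℕₚ.m≤m*n _ (D ^ 8) {{ℕₚ.m^n≢0 D 8}})
                   (ℕₚ.≤-trans (ℕₚ.≤-reflexive (vertices-eq D (suc s))) V≤B))
                 (ℕₚ.*-monoʳ-≤ 8 b≤t₀) v ℓ))))
      where
      n a b : ℕ
      n = 2 + s
      a = ℕ.⌈ n /2⌉
      b = ℕ.⌊ n /2⌋
      accₐ : Acc _<_ a
      accₐ = rs (ℕₚ.m<n⇒m<1+n (ℕₚ.⌈n/2⌉<n s))
      acc_b : Acc _<_ b
      acc_b = rs (ℕₚ.m<n⇒m<1+n (ℕₚ.⌊n/2⌋<n (suc s)))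
      a≤n : a ≤ n
      a≤n = ℕₚ.⌈n/2⌉≤n n
      b≤n : b ≤ n
      b≤n = ℕₚ.⌊n/2⌋≤n n
      n≤t₀ : n ≤ t₀
      n≤t₀ = ℕₚ.≤-trans (ℕₚ.n≤1+n n) t≤t₀
      b≤t₀ : b ≤ t₀
      b≤t₀ = ℕₚ.≤-trans b≤n n≤t₀
      n≤B : n ≤ B
      n≤B = ≤8t₀⇒≤B (ℕₚ.≤-trans n≤t₀ (ℕₚ.m≤n*m t₀ 8))
      V≤B : D ^ (8 * suc n) ≤ B
      V≤B = ^≤B (ℕₚ.*-monoʳ-≤ 8 t≤t₀)
      a≡n∸b : n ∸ b ≡ a
      a≡n∸b = trans (cong (_∸ b) (sym (ℕₚ.⌊n/2⌋+⌈n/2⌉≡n n))) (ℕₚ.m+n∸m≡n b a)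
      time : 18 + (298 + (72 * b + 2 * (unit * (a * a) + unit * (b * b)))) ≤ unit * (suc n * suc n)
      time = begin
        18 + (298 + (72 * b + 2 * (unit * (a * a) + unit * (b * b))))
          ≡⟨ regroup (72 * b) unit (a * a) (b * b) ⟩
        (316 + 72 * b) + unit * (2 * (a * a + b * b))
          ≤⟨ ℕₚ.+-monoˡ-≤ _ (ℕₚ.+-monoʳ-≤ 316 (ℕₚ.*-monoʳ-≤ 72 b≤t₀)) ⟩
        unit + unit * (2 * (a * a + b * b))
          ≡⟨ ℕₚ.*-suc unit (2 * (a * a + b * b)) ⟨
        unit * (1 + 2 * (a * a + b * b))
          ≤⟨ ℕₚ.*-monoʳ-≤ unit (halves-squared n) ⟩
        unit * (suc n * suc n) ∎
        where
        open ℕₚ.≤-Reasoning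
        regroup : ∀ m u x y → 18 + (298 + (m + 2 * (u * x + u * y))) ≡ (316 + m) + u * (2 * (x + y))
        regroup = solve-ℕ
      queries : 2 + 2 * (2 * (a * a) + 2 * (b * b)) ≤ 2 * (suc n * suc n)
      queries = ℕₚ.≤-trans (ℕₚ.≤-reflexive (regroup (a * a) (b * b))) (ℕₚ.*-monoʳ-≤ 2 (halves-squared n))
        where
        regroup : ∀ x y → 2 + 2 * (2 * x + 2 * y) ≡ 2 * (1 + 2 * (x + y))
        regroup = solve-ℕ

-- Polynomial bounds in t and log D.

module Resources where

  open import Data.Nat.Base using (_+_; _*_; _≤_)
  open Machine
  open RotationCost

  n≤2^n : ∀ n → n ≤ 2 ^ n
  n≤2^n zero    = z≤n
  n≤2^n (suc n) = ℕₚ.+-mono-≤ (ℕₚ.m^n>0 2 n) (ℕₚ.≤-trans (n≤2^n n) (ℕₚ.m≤m+n (2 ^ n) 0))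

  n≤2^[1+log₂n] : ∀ n → n ≤ 2 ^ suc ⌊log₂ n ⌋
  n≤2^[1+log₂n] n = ℕₚ.<⇒≤ (ℕₚ.≰⇒> λ 2^≤n → ℕₚ.<-irrefl refl
    (subst (_≤ ⌊log₂ n ⌋) (⌊log₂[2^n]⌋≡n (suc ⌊log₂ n ⌋)) (⌊log₂⌋-mono-≤ 2^≤n)))

  -- Variable 0 is `t` and variable 1 is `⌊log₂ D ⌋`. The first factor counts operations, with 5 for
  -- the call from `main`; the second is `size B` for the bound `B` chosen below.
  timeBound : Polynomial 2
  timeBound = (con 5 :+ (con 316 :+ con 72 :* var 0F) :* (var 0F :* var 0F)) :*
    (con 1 :+ con 8 :* var 0F :* (con 1 :+ var 1F))

  queryBound : Polynomial 1
  queryBound = con 2 :* (var 0F :* var 0F)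

  family-runs : ∀ {D} .{{_ : NonZero D}} (H : Graph (Fin (D ^ 8)) (Fin D)) t .{{_ : NonZero t}} v ℓ →
    Σ[ T ∈ ℕ ] Σ[ Q ∈ ℕ ]
      Runs program H (t ∷ D ∷ toℕ v ∷ toℕ ℓ ∷ [])
        (toℕ (proj₁ (rot (family H t) (v , ℓ))) ∷ toℕ (proj₂ (rot (family H t) (v , ℓ))) ∷ []) T Q ×
      T ≤ ⟦ timeBound ⟧ (t ∷ ⌊log₂ D ⌋ ∷ []) × Q ≤ ⟦ queryBound ⟧ (t ∷ [])
  family-runs {D} H t v ℓ =
    let (T , Q , e , T≤ , Q≤ , _) = evaluate (call-costs (rotation-costs t (<-wellFounded t) ℕₚ.≤-refl v ℓ)) inputs≤B
    in T , Q , e , subst (λ s → T ≤ (5 + (316 + 72 * t) * (t * t)) * s) (cong suc (⌊log₂[2^n]⌋≡n bits)) T≤ , Q≤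
    where
    bits B : ℕ
    bits = 8 * t * suc ⌊log₂ D ⌋
    -- A power of two, so that `size B` is exactly `1 + bits`; the exponent suffices because
    -- `D ≤ 2 ^ (1 + ⌊log₂ D ⌋)`.
    B = 2 ^ bits
    1≤t : 1 ≤ t
    1≤t = ℕ.>-nonZero⁻¹ t
    8t≤B : 8 * t ≤ B
    8t≤B = ℕₚ.≤-trans (n≤2^n (8 * t)) (ℕₚ.^-monoʳ-≤ 2 (ℕₚ.m≤m*n (8 * t) (suc ⌊log₂ D ⌋)))
    D^8t≤B : D ^ (8 * t) ≤ B
    D^8t≤B = ℕₚ.≤-trans (ℕₚ.^-monoˡ-≤ (8 * t) (n≤2^[1+log₂n] D))
      (ℕₚ.≤-reflexive (trans (ℕₚ.^-*-assoc 2 (suc ⌊log₂ D ⌋) (8 * t))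
        (cong (2 ^_) (ℕₚ.*-comm (suc ⌊log₂ D ⌋) (8 * t)))))
    ^≤B : ∀ {k} → k ≤ 8 * t → D ^ k ≤ B
    ^≤B k≤ = ℕₚ.≤-trans (ℕₚ.^-monoʳ-≤ D k≤) D^8t≤B
    ≤8⇒≤8t : ∀ {k} → k ≤ 8 → k ≤ 8 * t
    ≤8⇒≤8t k≤8 = ℕₚ.≤-trans k≤8 (ℕₚ.m≤m*n 8 t)
    open Rotations H 1≤t 8t≤B D^8t≤B
    inputs≤B : All (_≤ B) (t ∷ D ∷ toℕ v ∷ toℕ ℓ ∷ [])
    inputs≤B = ℕₚ.≤-trans (ℕₚ.m≤n*m t 8) 8t≤B
      ∷ subst (_≤ B) (ℕₚ.*-identityʳ D) (^≤B (≤8⇒≤8t (s≤s z≤n)))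
      ∷ toℕ≤B D^8t≤B v ∷ toℕ≤B (^≤B (≤8⇒≤8t (s≤s (s≤s z≤n)))) ℓ ∷ []

open import Defs using (_+_; _*_; _≤_; _<_)

theorem3p3 :
  Σ[ C ∈ ℝ ] 0ℝ < C ×
  (Σ[ prog ∈ Program 4 2 ] Σ[ timeBound ∈ Polynomial 2 ] Σ[ queryBound ∈ Polynomial 1 ]
    ((D : ℕ) → .{{_ : NonZero D}} → (H : Graph (Fin (D ^ 8)) (Fin D)) → (μ : ℝ) →
     IsExpander H μ →
     (t : ℕ) → .{{_ : NonZero t}} →
     (Σ[ μₜ ∈ ℝ ] μₜ ≤ μ + C * (μ * μ) × IsExpander {{m^n≢0 D 2}} (family H t) μₜ) ×
     ((v : Fin (D ^ (8 ℕ.* t))) → (ℓ : Fin (D ^ 2)) →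
      Σ[ T ∈ ℕ ] Σ[ Q ∈ ℕ ]
        Runs prog H (t ∷ D ∷ toℕ v ∷ toℕ ℓ ∷ [])
          (toℕ (proj₁ (rot (family H t) (v , ℓ))) ∷ toℕ (proj₂ (rot (family H t) (v , ℓ))) ∷ [])
          T Q ×
        T ℕ.≤ ⟦ timeBound ⟧ (t ∷ ⌊log₂ D ⌋ ∷ []) ×
        Q ℕ.≤ ⟦ queryBound ⟧ (t ∷ []))))
theorem3p3 =
  fromℚ C , (C , ℚₚ.positive⁻¹ C , 0 , λ _ _ → ℚₚ.≤-reflexive (ℚₚ.+-identityˡ C)) ,
  program , timeBound , queryBound , λ D H μ H-μ t →
    -- The largest admissible value is taken for `μₜ`, which leaves only the expansion bound to
    -- prove.
    (μ + fromℚ C * (μ * μ) , ≤-refl (μ + fromℚ C * (μ * μ)) , family-IsExpander {H = H} {μ = μ} H-μ t) ,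
    family-runs H t
  where
  open FamilyExpansion using (5ℚ)
  open Continuity using (family-IsExpander)
  open Machine using (program)
  open Resources using (timeBound; queryBound; family-runs)
  C : ℚ
  C = 5ℚ ℚ.* 5ℚ
  ≤-refl : ∀ x → x ≤ x
  ≤-refl x ε 0<ε = 0 , λ n _ → Variance.≤-of-diff ε (ℚₚ.<⇒≤ 0<ε) refl
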